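{- Let $\boldsymbol{\mu}=(\mu_1,\ldots,\mu_n)$ be an $n$-tuple of umbral monomials with generating function $f(\boldsymbol{\mu},\boldsymbol{t}_{(n)})$ and let $\boldsymbol{\nu}=(\nu_1,\ldots,\nu_m)$ be an $m$-tuple of umbral monomials with generating function $f(\boldsymbol{\nu},\boldsymbol{t}_{(m)})$, where $\boldsymbol{t}_{(k)}=(t_1,\dots,t_k)$. Then the auxiliary umbra $(\mu_1+\cdots+\mu_n)\boldsymbol{.}\beta\boldsymbol{.}\boldsymbol{\nu}$ has generating function $$f[(\mu_1+\cdots+\mu_n)\boldsymbol{.}\beta\boldsymbol{.}\boldsymbol{\nu},\,\boldsymbol{t}_{(m)}]=f[\boldsymbol{\mu},(f(\boldsymbol{\nu},\boldsymbol{t}_{(m)})-1,\ldots,f(\boldsymbol{\nu},\boldsymbol{t}_{(m)})-1)],$$ an identity of formal power series in $t_1,\dots,t_m$ (with $n$ equal arguments on the right).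
   Context: $R$ is the real or complex field, $A$ is a set (the alphabet) whose elements are called umbrae, and $E:R[A]\to R$ is a linear functional (evaluation) with $E[1]=1$ and $E[\alpha^i\gamma^j\cdots]=E[\alpha^i]E[\gamma^j]\cdots$ for distinct umbrae and nonnegative integers $i,j,\dots$. A $k$-tuple $\boldsymbol{\mu}=(\mu_1,\dots,\mu_k)$ of umbral monomials (monomials in $R[A]$, supports not necessarily disjoint) has multivariate moments $E[\boldsymbol{\mu}^{\boldsymbol{i}}]$, $\boldsymbol{\mu}^{\boldsymbol{i}}=\mu_1^{i_1}\cdots\mu_k^{i_k}$, $\boldsymbol{i}\in\mathbb{N}_0^k$, and generating function $f(\boldsymbol{\mu},\boldsymbol{t}_{(k)})=1+\sum_{\boldsymbol{i}\neq\boldsymbol{0}}E[\boldsymbol{\mu}^{\boldsymbol{i}}]\,\boldsymbol{t}_{(k)}^{\boldsymbol{i}}/\boldsymbol{i}!$ with $\boldsymbol{i}!=i_1!\cdots i_k!$, $\boldsymbol{t}_{(k)}^{\boldsymbol{i}}=t_1^{i_1}\cdots t_k^{i_k}$. For formal power series $s_1,\dots,s_n$ without constant term, $f[\boldsymbol{\mu},(s_1,\dots,s_n)]$ denotes the substitution $t_j\mapsto s_j$ in $f(\boldsymbol{\mu},\boldsymbol{t}_{(n)})$. Partitions of a multi-index: a partition $\boldsymbol{\lambda}$ of $\boldsymbol{i}\in\mathbb{N}_0^m$, written $\boldsymbol{\lambda}\vdash\boldsymbol{i}$, is a matrix of nonnegative integers with $m$ rows, no zero column, columns in lexicographic order, and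 $r$-th row sum equal to $i_r$ for $r=1,\dots,m$. Its number of columns is $l(\boldsymbol{\lambda})$. Writing $\boldsymbol{\lambda}=(\boldsymbol{\lambda}_1^{r_1},\boldsymbol{\lambda}_2^{r_2},\dots)$ when the distinct column $\boldsymbol{\lambda}_j$ occurs $r_j$ times, set $\mathfrak{m}(\boldsymbol{\lambda})!=r_1!r_2!\cdots$ and $\boldsymbol{\lambda}!=\prod_j(\boldsymbol{\lambda}_j!)^{r_j}$ (product of factorials of all entries). With $h_{\boldsymbol{j}}=E[\boldsymbol{\nu}^{\boldsymbol{j}}]$ set $h_{\boldsymbol{\lambda}}=h_{\boldsymbol{\lambda}_1}^{r_1}h_{\boldsymbol{\lambda}_2}^{r_2}\cdots$. The auxiliary umbra $p\boldsymbol{.}\beta\boldsymbol{.}\boldsymbol{\nu}$ ($\beta$ denotes the Bell umbra), for an umbral polynomial $p\in R[A]$ (here $p=\mu_1+\cdots+\mu_n$), is the symbolic $m$-tuple defined by its moments $$E[(p\boldsymbol{.}\beta\boldsymbol{.}\boldsymbol{\nu})^{\boldsymbol{i}}]=\sum_{\boldsymbol{\lambda}\vdash\boldsymbol{i}}\frac{\boldsymbol{i}!}{\mathfrak{m}(\boldsymbol{\lambda})!\,\boldsymbol{\lambda}!}\,E[p^{\,l(\boldsymbol{\lambda})}]\,h_{\boldsymbol{\lambda}},\qquad \boldsymbol{i}\in\mathbb{N}_0^m,$$ and its generating function is $1+\sum_{\boldsymbol{i}\ne\boldsymbol{0}}E[(p\boldsymbol{.}\beta\boldsymbol{.}\boldsymbol{\nu})^{\boldsymbol{i}}]\,\boldsymbol{t}_{(m)}^{\boldsymbol{i}}/\boldsymbol{i}!$.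 -}

module Defs where

open import Level using (Level; _⊔_)
open import Algebra.Apartness.Bundles using (HeytingField; HeytingCommutativeRing)
open import Algebra.Bundles using (CommutativeRing; RawRing)
open import Algebra.Module.Bundles.Raw using (RawLeftModule)
import Algebra.Module.Construct.TensorUnit as TensorUnit
open import Algebra.Module.Morphism.Structures using (module LeftModuleMorphisms)
import Algebra.Definitions.RawSemiring as RawSemiringDefs
open import Data.Bool.Base using (if_then_else_)
open import Data.List.Base as List
  using (List; []; _∷_; [_]; upTo; filter; deduplicate; concatMap; cartesianProductWith)
open import Data.List.Relation.Unary.All as All using (All)
open import Data.List.Relation.Unary.Linked using (linked?)
import Data.List.Relation.Unary.Sorted.TotalOrder as SortedTO
open import Data.List.Relation.Unary.Unique.Propositional using (Unique)
open import Data.Nat.Base as ℕ using (ℕ; zero; suc; NonZero; _!; _∸_)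
open import Data.Nat.ListAction using (product)
import Data.Nat.Properties as ℕ
open import Data.Product.Base using (Σ-syntax; _×_; _,_; proj₁)
open import Data.Vec.Base as Vec using (Vec; []; _∷_; replicate; zipWith)
import Data.Vec.Properties as Vec
import Data.Vec.Relation.Binary.Lex.NonStrict as Lex
open import Relation.Binary.Bundles using (TotalOrder)
open import Relation.Binary.PropositionalEquality.Core using (_≡_; _≢_)
open import Relation.Nullary using (Dec; yes; no; does; ¬?; contradiction; _×-dec_)

MultiIndex : ℕ → Set
MultiIndex k = Vec ℕ k

infix 4 _≟_
_≟_ : ∀ {k} (i j : MultiIndex k) → Dec (i ≡ j)
_≟_ = Vec.≡-dec ℕ._≟_

𝟎 : ∀ {k} → MultiIndex k
𝟎 = replicate _ 0

∣_∣ : ∀ {k} → MultiIndex k → ℕ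
∣_∣ = Vec.sum

infix 9 _!ᵛ
_!ᵛ : ∀ {k} → MultiIndex k → ℕ
[]       !ᵛ = 1
(n ∷ ns) !ᵛ = n ! ℕ.* ns !ᵛ

-- All j with j ≤ i componentwise, each exactly once.
box : ∀ {k} → MultiIndex k → List (MultiIndex k)
box []       = [ [] ]
box (n ∷ ns) = cartesianProductWith _∷_ (upTo (suc n)) (box ns)

-- A matrix with m rows, given as the list of its columns.
Matrix : ℕ → Set
Matrix m = List (Vec ℕ m)

lex : ℕ → TotalOrder _ _ _
lex = Lex.≤-totalOrder ℕ.≤-totalOrder ℕ._≟_

rowSums : ∀ {m} → Matrix m → MultiIndex m
rowSums = List.foldr (zipWith ℕ._+_) 𝟎

IsPartition : ∀ {m} → MultiIndex m → Matrix m → Set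
IsPartition {m} i Λ = All (_≢ 𝟎) Λ × SortedTO.Sorted (lex m) Λ × rowSums Λ ≡ i

isPartition? : ∀ {m} (i : MultiIndex m) (Λ : Matrix m) → Dec (IsPartition i Λ)
isPartition? i Λ =
  All.all? (λ v → ¬? (v ≟ 𝟎)) Λ
  ×-dec linked? (Lex.≤-dec ℕ._≟_ ℕ._≤?_) Λ
  ×-dec (rowSums Λ ≟ i)

lists : ∀ {b} {B : Set b} → List B → ℕ → List (List B)
lists xs zero    = [ [] ]
lists xs (suc l) = cartesianProductWith _∷_ xs (lists xs l)

-- The set of all Λ ⊢ i, without repetition.  Nothing is lost by bounding
-- the search: a column of Λ is ≤ i componentwise, and, having no zero
-- column, Λ has at most ∣ i ∣ columns.
partitions : ∀ {m} → MultiIndex m → List (Matrix m)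
partitions i = filter (isPartition? i) (concatMap (lists (box i)) (upTo (suc ∣ i ∣)))

multiplicity : ∀ {m} → Vec ℕ m → Matrix m → ℕ
multiplicity v Λ = List.length (filter (v ≟_) Λ)

-- 𝔪(Λ)! : one factor r! for each distinct column, r its multiplicity.
𝔪_! : ∀ {m} → Matrix m → ℕ
𝔪 Λ ! = product (List.map (λ v → multiplicity v Λ !) (deduplicate _≟_ Λ))

-- Λ! : repeated columns contribute repeatedly.
infix 9 _!ᴹ
_!ᴹ : ∀ {m} → Matrix m → ℕ
Λ !ᴹ = product (List.map _!ᵛ Λ)

!ᵛ≢0 : ∀ {k} (i : MultiIndex k) → NonZero (i !ᵛ)
!ᵛ≢0 []       = _
!ᵛ≢0 (n ∷ ns) = ℕ.m*n≢0 (n !) (ns !ᵛ) {{ℕ._!≢0 n}} {{ !ᵛ≢0 ns}}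

product-map≢0 : ∀ {b} {B : Set b} (f : B → ℕ) → (∀ x → NonZero (f x)) →
                ∀ xs → NonZero (product (List.map f xs))
product-map≢0 f f≢0 []       = _
product-map≢0 f f≢0 (x ∷ xs) =
  ℕ.m*n≢0 (f x) _ {{f≢0 x}} {{product-map≢0 f f≢0 xs}}

𝔪Λ!*Λ!≢0 : ∀ {m} (Λ : Matrix m) → NonZero (𝔪 Λ ! ℕ.* Λ !ᴹ)
𝔪Λ!*Λ!≢0 Λ = ℕ.m*n≢0 (𝔪 Λ !) (Λ !ᴹ)
  {{product-map≢0 _ (λ v → ℕ._!≢0 (multiplicity v Λ)) (deduplicate _≟_ Λ)}}
  {{product-map≢0 _ !ᵛ≢0 Λ}}

-- The scalars are an arbitrary field of characteristic zero.  Fields are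
-- Heyting fields, so that the real and the complex numbers are instances
-- constructively.
module _ {c ℓ₁ ℓ₂} (F : HeytingField c ℓ₁ ℓ₂) where

  open HeytingField F
  open RawSemiringDefs
    (RawRing.rawSemiring (CommutativeRing.rawRing
      (HeytingCommutativeRing.commutativeRing heytingCommutativeRing)))
    using () renaming (_×_ to _·_)

  CharacteristicZero : Set ℓ₂
  CharacteristicZero = ∀ n → .{{NonZero n}} → (n · 1#) # 0#

module Scalars {c ℓ₁ ℓ₂} (F : HeytingField c ℓ₁ ℓ₂) (char0 : CharacteristicZero F) where

  open HeytingField F public

  commutativeRing : CommutativeRing c ℓ₁
  commutativeRing = HeytingCommutativeRing.commutativeRing heytingCommutativeRing

  open RawSemiringDefs (RawRing.rawSemiring (CommutativeRing.rawRing commutativeRing)) public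
    using () renaming (_×_ to _·_)

  fromℕ : ℕ → Carrier
  fromℕ n = n · 1#

  -- #⇒invertible yields an inverse of the difference fromℕ n - 0#.
  1/_ : ∀ n → .{{NonZero n}} → Carrier
  1/ n = proj₁ (#⇒invertible (char0 n))

  ∑ : ∀ {b} {B : Set b} → List B → (B → Carrier) → Carrier
  ∑ xs f = List.foldr _+_ 0# (List.map f xs)

  ∏ : ∀ {b} {B : Set b} → List B → (B → Carrier) → Carrier
  ∏ xs f = List.foldr _*_ 1# (List.map f xs)

  syntax ∑ xs (λ x → e) = ∑[ x ← xs ] e
  syntax ∏ xs (λ x → e) = ∏[ x ← xs ] e

module PowerSeries {c ℓ₁ ℓ₂} (F : HeytingField c ℓ₁ ℓ₂) (char0 : CharacteristicZero F) where

  open Scalars F char0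

  -- Formal power series in k variables, given by their coefficients.
  Series : ℕ → Set c
  Series k = MultiIndex k → Carrier

  infix 4 _≈ˢ_
  _≈ˢ_ : ∀ {k} → Series k → Series k → Set ℓ₁
  f ≈ˢ g = ∀ i → f i ≈ g i

  1ˢ : ∀ {k} → Series k
  1ˢ i = if does (i ≟ 𝟎) then 1# else 0#

  infixl 6 _-ˢ_
  _-ˢ_ : ∀ {k} → Series k → Series k → Series k
  (f -ˢ g) i = f i - g i

  infixl 7 _*ˢ_
  _*ˢ_ : ∀ {k} → Series k → Series k → Series k
  (f *ˢ g) i = ∑[ j ← box i ] (f j * g (zipWith _∸_ i j))

  infixr 8 _^ˢ_
  _^ˢ_ : ∀ {k} → Series k → ℕ → Series k
  f ^ˢ zero  = 1ˢ
  f ^ˢ suc n = f *ˢ f ^ˢ n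

  Series₀ : ℕ → Set (c ⊔ ℓ₁)
  Series₀ k = Σ[ f ∈ Series k ] f 𝟎 ≈ 0#

  monomialˢ : ∀ {n k} → Vec (Series₀ k) n → MultiIndex n → Series k
  monomialˢ []             []       = 1ˢ
  monomialˢ ((s , _) ∷ ss) (j ∷ js) = s ^ˢ j *ˢ monomialˢ ss js

  -- The substitution tₖ ↦ sₖ, that is Σⱼ fⱼ s₁^j₁ ⋯ sₙ^jₙ.  As the sₖ have
  -- no constant term, s^j has order ≥ ∣ j ∣; so the terms with some
  -- jₖ > ∣ i ∣ do not contribute to the coefficient at i, and the sum
  -- over all j ∈ ℕⁿ reduces to the finite one below.
  infixl 9 _⟦_⟧ˢ
  _⟦_⟧ˢ : ∀ {n k} → Series n → Vec (Series₀ k) n → Series k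
  (f ⟦ s ⟧ˢ) i = ∑[ j ← box (replicate _ ∣ i ∣) ] (f j * monomialˢ s j i)

  -- 1 + Σ_{i ≠ 0} aᵢ tⁱ / i!
  egf : ∀ {k} → (MultiIndex k → Carrier) → Series k
  egf a i = if does (i ≟ 𝟎) then 1# else a i * (1/ (i !ᵛ)) {{ !ᵛ≢0 i}}

  egf-1-constant : ∀ {k} (a : MultiIndex k → Carrier) → (egf a -ˢ 1ˢ) 𝟎 ≈ 0#
  egf-1-constant {k} a with 𝟎 {k} ≟ 𝟎
  ... | yes _   = -‿inverseʳ 1#
  ... | no  0≢0 = contradiction _≡_.refl 0≢0

  egf-1 : ∀ {k} → (MultiIndex k → Carrier) → Series₀ k
  egf-1 a = egf a -ˢ 1ˢ , egf-1-constant a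

module Umbral
  {c ℓ₁ ℓ₂ a} (F : HeytingField c ℓ₁ ℓ₂) (char0 : CharacteristicZero F) (A : Set a)
  where

  open Scalars F char0
  open PowerSeries F char0 public

  -- The polynomial ring R[A] as the free commutative R-algebra on A:
  -- polynomial expressions modulo the laws of commutative R-algebras.
  -- No decidability of equality on A or R is needed.
  infixl 6 _⊕_
  infixl 7 _⊗_
  infix  8 ⊝_
  data R[A] : Set (c ⊔ a) where
    con : Carrier → R[A]
    var : A → R[A]
    _⊕_ : R[A] → R[A] → R[A]
    _⊗_ : R[A] → R[A] → R[A]
    ⊝_  : R[A] → R[A]

  infix 4 _≋_
  data _≋_ : R[A] → R[A] → Set (c ⊔ ℓ₁ ⊔ a) where
    ≋-refl      : ∀ {p} → p ≋ p
    ≋-sym       : ∀ {p q} → p ≋ q → q ≋ p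
    ≋-trans     : ∀ {p q r} → p ≋ q → q ≋ r → p ≋ r
    ⊕-cong      : ∀ {p p′ q q′} → p ≋ p′ → q ≋ q′ → p ⊕ q ≋ p′ ⊕ q′
    ⊗-cong      : ∀ {p p′ q q′} → p ≋ p′ → q ≋ q′ → p ⊗ q ≋ p′ ⊗ q′
    ⊝-cong      : ∀ {p p′} → p ≋ p′ → ⊝ p ≋ ⊝ p′
    ⊕-assoc     : ∀ p q r → (p ⊕ q) ⊕ r ≋ p ⊕ (q ⊕ r)
    ⊕-comm      : ∀ p q → p ⊕ q ≋ q ⊕ p
    ⊕-identityˡ : ∀ p → con 0# ⊕ p ≋ p
    ⊝-inverseˡ  : ∀ p → ⊝ p ⊕ p ≋ con 0#
    ⊗-assoc     : ∀ p q r → (p ⊗ q) ⊗ r ≋ p ⊗ (q ⊗ r)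
    ⊗-comm      : ∀ p q → p ⊗ q ≋ q ⊗ p
    ⊗-identityˡ : ∀ p → con 1# ⊗ p ≋ p
    ⊗-distribˡ  : ∀ p q r → p ⊗ (q ⊕ r) ≋ p ⊗ q ⊕ p ⊗ r
    con-cong    : ∀ {x y} → x ≈ y → con x ≋ con y
    con-+       : ∀ x y → con (x + y) ≋ con x ⊕ con y
    con-*       : ∀ x y → con (x * y) ≋ con x ⊗ con y

  polynomialRing : CommutativeRing (c ⊔ a) (c ⊔ ℓ₁ ⊔ a)
  polynomialRing = record
    { Carrier = R[A]
    ; _≈_     = _≋_
    ; _+_     = _⊕_
    ; _*_     = _⊗_
    ; -_      = ⊝_
    ; 0#      = con 0#
    ; 1#      = con 1#
    ; isCommutativeRing = record
      { isRing = record
        { +-isAbelianGroup = record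
          { isGroup = record
            { isMonoid = record
              { isSemigroup = record
                { isMagma = record
                  { isEquivalence = record { refl = ≋-refl ; sym = ≋-sym ; trans = ≋-trans }
                  ; ∙-cong = ⊕-cong
                  }
                ; assoc = ⊕-assoc
                }
              ; identity = ⊕-identityˡ , λ p → ≋-trans (⊕-comm _ _) (⊕-identityˡ p)
              }
            ; inverse = ⊝-inverseˡ , λ p → ≋-trans (⊕-comm _ _) (⊝-inverseˡ p)
            ; ⁻¹-cong = ⊝-cong
            }
          ; comm = ⊕-comm
          }
        ; *-cong     = ⊗-cong
        ; *-assoc    = ⊗-assoc
        ; *-identity = ⊗-identityˡ , λ p → ≋-trans (⊗-comm _ _) (⊗-identityˡ p)
        ; distrib    = ⊗-distribˡ , λ p q r →
            ≋-trans (⊗-comm _ _) (≋-trans (⊗-distribˡ p q r) (⊕-cong (⊗-comm _ _) (⊗-comm _ _)))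
        }
      ; *-comm = ⊗-comm
      }
    }

  open RawSemiringDefs (RawRing.rawSemiring (CommutativeRing.rawRing polynomialRing)) public
    using () renaming (_^_ to _^ᵖ_)

  polynomialModule : RawLeftModule Carrier (c ⊔ a) (c ⊔ ℓ₁ ⊔ a)
  polynomialModule = record
    { Carrierᴹ = R[A]
    ; _≈ᴹ_     = _≋_
    ; _+ᴹ_     = _⊕_
    ; _*ₗ_     = λ x p → con x ⊗ p
    ; 0ᴹ       = con 0#
    ; -ᴹ_      = ⊝_
    }

  scalarModule : RawLeftModule Carrier c ℓ₁
  scalarModule = TensorUnit.rawLeftModule {R = CommutativeRing.rawRing commutativeRing}

  open LeftModuleMorphisms polynomialModule scalarModule using (IsLeftModuleHomomorphism)

  -- (α , i) ∷ (γ , j) ∷ … stands for the monomial αⁱ γʲ ⋯ ; the umbrae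
  -- listed need not be distinct.
  Monomial : Set a
  Monomial = List (A × ℕ)

  ⟦_⟧ : Monomial → R[A]
  ⟦ M ⟧ = List.foldr _⊗_ (con 1#) (List.map (λ (α , i) → var α ^ᵖ i) M)

  record Evaluation : Set (c ⊔ ℓ₁ ⊔ a) where
    field
      E            : R[A] → Carrier
      linear       : IsLeftModuleHomomorphism E
      normalised   : E (con 1#) ≈ 1#
      uncorrelated : ∀ (M : Monomial) → Unique (List.map proj₁ M) →
                     E ⟦ M ⟧ ≈ ∏ M (λ (α , i) → E (var α ^ᵖ i))

  infixr 8 _^ᵗ_
  _^ᵗ_ : ∀ {k} → Vec Monomial k → MultiIndex k → R[A]
  []       ^ᵗ []       = con 1#
  (M ∷ Ms) ^ᵗ (i ∷ is) = ⟦ M ⟧ ^ᵖ i ⊗ Ms ^ᵗ is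

  total : ∀ {k} → Vec Monomial k → R[A]
  total μ = Vec.foldr _ _⊕_ (con 0#) (Vec.map ⟦_⟧ μ)

  module _ (ev : Evaluation) where

    open Evaluation ev

    moment : ∀ {k} → Vec Monomial k → MultiIndex k → Carrier
    moment μ i = E (μ ^ᵗ i)

    -- The moments of the auxiliary umbra p.β.ν.
    momentβ : ∀ {m} → R[A] → Vec Monomial m → MultiIndex m → Carrier
    momentβ p ν i =
      ∑[ Λ ← partitions i ]
        (fromℕ (i !ᵛ) * (1/ (𝔪 Λ ! ℕ.* Λ !ᴹ)) {{𝔪Λ!*Λ!≢0 Λ}}
          * E (p ^ᵖ List.length Λ)
          * (∏[ v ← Λ ] moment ν v))

{-# OPTIONS --safe #-}

-- Both sides have i-th coefficient Σₗ E[pˡ]/l! · [tⁱ] gˡ, where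
-- p = μ₁ + ⋯ + μₙ and g = f(ν, t) − 1.  On the right this is the multinomial
-- theorem in R[A], as every argument of the substitution equals g.  On the
-- left, expand gˡ/l! = (Σᵥ gᵥ tᵛ)ˡ/l! by adjoining one monomial at a time to
-- the sum, using (x + y)ˡ/l! = Σ xᵃ/a! · yᵇ/b!: the summands are indexed by
-- sorted words in the exponents v, that is by partitions Λ, with weight
-- 1/𝔪(Λ)!.
module Submission where

open import Defs
open import Algebra.Apartness.Bundles using (HeytingField)
open import Algebra.Bundles using (CommutativeSemiring; CommutativeRing)
open import Algebra.Module.Morphism.Structures using (module LeftModuleMorphisms)
import Algebra.Properties.CommutativeSemigroup as CommutativeSemigroupProperties
open import Algebra.Structures.Biased using (isCommutativeSemiringˡ)
open import Data.Bool.Base using (if_then_else_)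
open import Data.List.Base as List
  using (List; []; _∷_; _++_; upTo; concatMap; cartesianProductWith; filter; deduplicate)
open import Data.List.Properties
  using (map-upTo; map-∘; map-cong-local; filter-all; filter-none; filter-accept; filter-reject)
open import Data.List.Relation.Unary.All as All using (All; []; _∷_)
import Data.List.Relation.Unary.All.Properties as All
open import Data.List.Relation.Unary.AllPairs as AllPairs using (AllPairs; []; _∷_)
import Data.List.Relation.Unary.AllPairs.Properties as AllPairs
open import Data.List.Relation.Unary.Linked as Linked using (Linked; []; [-]; _∷_; linked?)
open import Data.List.Relation.Unary.Linked.Properties using (Linked⇒All)
open import Data.Nat.Base as ℕ using (ℕ; zero; suc; NonZero; _!; _∸_)
open import Data.Nat.ListAction using (product)
import Data.Nat.Properties as ℕ
open import Data.Product.Base using (_×_; _,_; proj₁; proj₂)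
open import Data.Vec.Base as Vec using (Vec; []; _∷_; replicate; zipWith)
import Data.Vec.Properties as Vec
import Data.Vec.Relation.Binary.Lex.NonStrict as Lex
open import Function.Base using (_∘_)
open import Relation.Binary.Bundles using (TotalOrder)
open import Relation.Binary.PropositionalEquality as ≡ using (_≡_; _≢_)
open import Relation.Binary.Structures using (IsEquivalence)
open import Relation.Nullary using (Dec; yes; no; does; ¬_; ¬?; contradiction)
open import Relation.Unary using (Decidable)

-- The divided powers xⁿ/n! make the binomial and multinomial theorems free of coefficients. They
-- are needed both in R[A] and in the power series, so their theory is set in a commutative semiring
-- with a chosen inverse of every positive integer. Three obstacles shape the rest. The sum g = Σ gᵥ
-- tᵛ is infinite, while words are drawn from a finite alphabet: the coefficient at i only sees
-- exponents v ≤ i, so g is replaced by its part over `box i`. Partitions exclude zero columns,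
-- words over `box i` do not: as g has no constant term, a word with a zero column has weight zero.
-- Finally, `egf` prescribes the coefficient 1 at `𝟎` whatever the moments are, so this coefficient
-- is checked separately.

infixl 6 _⊞_
_⊞_ : ∀ {k} → MultiIndex k → MultiIndex k → MultiIndex k
_⊞_ = zipWith ℕ._+_

-- Finite sums and products in a commutative semiring

module Sums {c ℓ} (S : CommutativeSemiring c ℓ) where

  open CommutativeSemiring S hiding (zero)
  open import Relation.Binary.Reasoning.Setoid setoid
  open import Algebra.Properties.CommutativeSemigroup
    +-commutativeSemigroup using (interchange)
  open import Algebra.Properties.CommutativeSemigroup
    *-commutativeSemigroup using () renaming (interchange to *-interchange)

  ∑ : ∀ {b} {B : Set b} → List B → (B → Carrier) → Carrier
  ∑ xs f = List.foldr _+_ 0# (List.map f xs)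

  ∏ : ∀ {b} {B : Set b} → List B → (B → Carrier) → Carrier
  ∏ xs f = List.foldr _*_ 1# (List.map f xs)

  when : ∀ {p} {P : Set p} → Dec P → Carrier → Carrier
  when P? x = if does P? then x else 0#

  module _ {p} {P : Set p} where

    when-yes : (P? : Dec P) → P → ∀ {x} → when P? x ≈ x
    when-yes (yes _) _ = refl
    when-yes (no ¬p) p = contradiction p ¬p

    when-no : (P? : Dec P) → ¬ P → ∀ {x} → when P? x ≈ 0#
    when-no (yes p) ¬p = contradiction p ¬p
    when-no (no _)  _  = refl

    when-congʳ : (P? : Dec P) → ∀ {x y} → x ≈ y → when P? x ≈ when P? y
    when-congʳ (yes _) x≈y = x≈y
    when-congʳ (no _)  _   = refl

    when-0 : (P? : Dec P) → ∀ {x} → x ≈ 0# → when P? x ≈ 0#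
    when-0 (yes _) x≈0 = x≈0
    when-0 (no _)  _   = refl

    when-+ : (P? : Dec P) → ∀ x y → when P? (x + y) ≈ when P? x + when P? y
    when-+ (yes _) x y = refl
    when-+ (no _)  x y = sym (+-identityˡ 0#)

    *-when : (P? : Dec P) → ∀ x y → x * when P? y ≈ when P? (x * y)
    *-when (yes _) x y = refl
    *-when (no _)  x y = zeroʳ x

  when-⇔ : ∀ {p q} {P : Set p} {Q : Set q} (P? : Dec P) (Q? : Dec Q) →
           (P → Q) → (Q → P) → ∀ {x} → when P? x ≈ when Q? x
  when-⇔ (yes p) Q? P⇒Q Q⇒P = sym (when-yes Q? (P⇒Q p))
  when-⇔ (no ¬p) Q? P⇒Q Q⇒P = sym (when-no Q? (¬p ∘ Q⇒P))

  module _ {b} {B : Set b} where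

    ∑-congᴬ : ∀ {xs : List B} {f g} → All (λ x → f x ≈ g x) xs → ∑ xs f ≈ ∑ xs g
    ∑-congᴬ []           = refl
    ∑-congᴬ (fx≈gx ∷ ps) = +-cong fx≈gx (∑-congᴬ ps)

    ∑-cong : ∀ (xs : List B) {f g} → (∀ x → f x ≈ g x) → ∑ xs f ≈ ∑ xs g
    ∑-cong xs f≈g = ∑-congᴬ (All.universal f≈g xs)

    ∑-0 : ∀ (xs : List B) {f} → (∀ x → f x ≈ 0#) → ∑ xs f ≈ 0#
    ∑-0 []       f≈0 = refl
    ∑-0 (x ∷ xs) f≈0 = trans (+-cong (f≈0 x) (∑-0 xs f≈0)) (+-identityˡ 0#)

    ∑-++ : ∀ (xs : List B) {ys} f → ∑ (xs ++ ys) f ≈ ∑ xs f + ∑ ys f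
    ∑-++ []       f = sym (+-identityˡ _)
    ∑-++ (x ∷ xs) f = trans (+-congˡ (∑-++ xs f)) (sym (+-assoc _ _ _))

    ∑-filter : ∀ {p} {P : B → Set p} (P? : Decidable P) xs f →
               ∑ (filter P? xs) f ≈ ∑ xs (λ x → when (P? x) (f x))
    ∑-filter P? []       f = refl
    ∑-filter P? (x ∷ xs) f with P? x
    ... | yes _ = +-congˡ (∑-filter P? xs f)
    ... | no  _ = trans (∑-filter P? xs f) (sym (+-identityˡ _))

    ∑-* : ∀ (xs : List B) y f → y * ∑ xs f ≈ ∑ xs (λ x → y * f x)
    ∑-* []       y f = zeroʳ y
    ∑-* (x ∷ xs) y f = trans (distribˡ _ _ _) (+-congˡ (∑-* xs y f))

    ∏-congᴬ : ∀ {xs : List B} {f g} → All (λ x → f x ≈ g x) xs → ∏ xs f ≈ ∏ xs g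
    ∏-congᴬ []           = refl
    ∏-congᴬ (fx≈gx ∷ ps) = *-cong fx≈gx (∏-congᴬ ps)

    ∏-* : ∀ (xs : List B) f g → ∏ xs (λ x → f x * g x) ≈ ∏ xs f * ∏ xs g
    ∏-* []       f g = sym (*-identityˡ 1#)
    ∏-* (x ∷ xs) f g = trans (*-congˡ (∏-* xs f g)) (*-interchange _ _ _ _)

  ∑-map : ∀ {a b} {A : Set a} {B : Set b} (g : A → B) xs f → ∑ (List.map g xs) f ≡ ∑ xs (f ∘ g)
  ∑-map g xs f = ≡.cong (List.foldr _+_ 0#) (≡.sym (map-∘ xs))

  ∑-concatMap : ∀ {a b} {A : Set a} {B : Set b} (h : A → List B) xs f →
                ∑ (concatMap h xs) f ≈ ∑ xs (λ x → ∑ (h x) f)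
  ∑-concatMap h []       f = refl
  ∑-concatMap h (x ∷ xs) f = trans (∑-++ (h x) f) (+-congˡ (∑-concatMap h xs f))

  ∑-cartesianProductWith : ∀ {a b d} {A : Set a} {B : Set b} {D : Set d} (h : A → B → D) xs ys f →
    ∑ (cartesianProductWith h xs ys) f ≈ ∑ xs (λ x → ∑ ys (λ y → f (h x y)))
  ∑-cartesianProductWith h []       ys f = refl
  ∑-cartesianProductWith h (x ∷ xs) ys f =
    trans (∑-++ (List.map (h x) ys) f)
      (+-cong (reflexive (∑-map (h x) ys f)) (∑-cartesianProductWith h xs ys f))

  -- Σ_{a + b = n} f a b
  ∑₂ : ℕ → (ℕ → ℕ → Carrier) → Carrier
  ∑₂ zero    f = f 0 0
  ∑₂ (suc n) f = f 0 (suc n) + ∑₂ n (λ a b → f (suc a) b)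

  -- The summation of a Cauchy product, with both parts of the index passed to `f`. This keeps
  -- truncated subtraction out of all manipulations; `∑-box` translates from the form used in
  -- `_*ˢ_`.
  ∑₂ᵛ : ∀ {k} → MultiIndex k → (MultiIndex k → MultiIndex k → Carrier) → Carrier
  ∑₂ᵛ []       f = f [] []
  ∑₂ᵛ (n ∷ ns) f = ∑₂ n (λ a b → ∑₂ᵛ ns (λ as bs → f (a ∷ as) (b ∷ bs)))

  ∑₂-cong : ∀ n {f g} → (∀ a b → a ℕ.+ b ≡ n → f a b ≈ g a b) → ∑₂ n f ≈ ∑₂ n g
  ∑₂-cong zero    f≈g = f≈g 0 0 ≡.refl
  ∑₂-cong (suc n) f≈g =
    +-cong (f≈g 0 (suc n) ≡.refl) (∑₂-cong n (λ a b eq → f≈g (suc a) b (≡.cong suc eq)))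

  ∑₂ᵛ-cong : ∀ {k} (i : MultiIndex k) {f g} →
             (∀ j l → j ⊞ l ≡ i → f j l ≈ g j l) → ∑₂ᵛ i f ≈ ∑₂ᵛ i g
  ∑₂ᵛ-cong []       f≈g = f≈g [] [] ≡.refl
  ∑₂ᵛ-cong (n ∷ ns) f≈g = ∑₂-cong n (λ a b p →
    ∑₂ᵛ-cong ns (λ as bs q → f≈g (a ∷ as) (b ∷ bs) (≡.cong₂ _∷_ p q)))

  ∑₂-0 : ∀ n {f} → (∀ a b → a ℕ.+ b ≡ n → f a b ≈ 0#) → ∑₂ n f ≈ 0#
  ∑₂-0 zero    f≈0 = f≈0 0 0 ≡.refl
  ∑₂-0 (suc n) f≈0 = trans
    (+-cong (f≈0 0 (suc n) ≡.refl) (∑₂-0 n (λ a b eq → f≈0 (suc a) b (≡.cong suc eq))))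
    (+-identityˡ 0#)

  ∑₂ᵛ-0 : ∀ {k} (i : MultiIndex k) {f} → (∀ j l → j ⊞ l ≡ i → f j l ≈ 0#) → ∑₂ᵛ i f ≈ 0#
  ∑₂ᵛ-0 []       f≈0 = f≈0 [] [] ≡.refl
  ∑₂ᵛ-0 (n ∷ ns) f≈0 = ∑₂-0 n (λ a b p →
    ∑₂ᵛ-0 ns (λ as bs q → f≈0 (a ∷ as) (b ∷ bs) (≡.cong₂ _∷_ p q)))

  ∑₂-single : ∀ n u v {f} → u ℕ.+ v ≡ n →
              (∀ a b → a ℕ.+ b ≡ n → a ≢ u → f a b ≈ 0#) → ∑₂ n f ≈ f u v
  ∑₂-single zero    zero    zero ≡.refl f≈0 = refl
  ∑₂-single (suc n) zero    _    ≡.refl f≈0 = trans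
    (+-congˡ (∑₂-0 n (λ a b eq → f≈0 (suc a) b (≡.cong suc eq) λ ())))
    (+-identityʳ _)
  ∑₂-single (suc n) (suc u) v    eq     f≈0 = trans
    (+-cong (f≈0 0 (suc n) ≡.refl λ ())
      (∑₂-single n u v (ℕ.suc-injective eq)
        (λ a b p a≢u → f≈0 (suc a) b (≡.cong suc p) (a≢u ∘ ℕ.suc-injective))))
    (+-identityˡ _)

  ∑₂ᵛ-single : ∀ {k} (i u v : MultiIndex k) {f} → u ⊞ v ≡ i →
               (∀ j l → j ⊞ l ≡ i → j ≢ u → f j l ≈ 0#) → ∑₂ᵛ i f ≈ f u v
  ∑₂ᵛ-single []       []       []       eq f≈0 = refl
  ∑₂ᵛ-single (n ∷ ns) (u ∷ us) (v ∷ vs) eq f≈0 = trans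
    (∑₂-single n u v (Vec.∷-injectiveˡ eq) (λ a b p a≢u →
      ∑₂ᵛ-0 ns (λ as bs q → f≈0 (a ∷ as) (b ∷ bs) (≡.cong₂ _∷_ p q) (a≢u ∘ Vec.∷-injectiveˡ))))
    (∑₂ᵛ-single ns us vs (Vec.∷-injectiveʳ eq) (λ as bs q as≢us →
      f≈0 (u ∷ as) (v ∷ bs) (≡.cong₂ _∷_ (Vec.∷-injectiveˡ eq) q) (as≢us ∘ Vec.∷-injectiveʳ)))

  ∑₂-+ : ∀ n f g → ∑₂ n (λ a b → f a b + g a b) ≈ ∑₂ n f + ∑₂ n g
  ∑₂-+ zero    f g = refl
  ∑₂-+ (suc n) f g = trans (+-congˡ (∑₂-+ n _ _)) (interchange _ _ _ _)

  ∑₂ᵛ-+ : ∀ {k} (i : MultiIndex k) f g → ∑₂ᵛ i (λ j l → f j l + g j l) ≈ ∑₂ᵛ i f + ∑₂ᵛ i g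
  ∑₂ᵛ-+ []       f g = refl
  ∑₂ᵛ-+ (n ∷ ns) f g = trans (∑₂-cong n (λ a b _ → ∑₂ᵛ-+ ns _ _)) (∑₂-+ n _ _)

  ∑₂-* : ∀ n x f → x * ∑₂ n f ≈ ∑₂ n (λ a b → x * f a b)
  ∑₂-* zero    x f = refl
  ∑₂-* (suc n) x f = trans (distribˡ _ _ _) (+-congˡ (∑₂-* n x _))

  ∑₂ᵛ-* : ∀ {k} (i : MultiIndex k) x f → x * ∑₂ᵛ i f ≈ ∑₂ᵛ i (λ j l → x * f j l)
  ∑₂ᵛ-* []       x f = refl
  ∑₂ᵛ-* (n ∷ ns) x f = trans (∑₂-* n x _) (∑₂-cong n (λ a b _ → ∑₂ᵛ-* ns x _))

  -- Additivity of T suffices, as `∑₂ n` has n + 1 summands and is never empty. T is abstract so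
  -- that it can be `∑₂ᵛ`, with X the type of pairs of its two indices.
  ∑₂-swap : ∀ {x} {X : Set x} (T : (X → Carrier) → Carrier) →
            (∀ g h → T (λ y → g y + h y) ≈ T g + T h) →
            ∀ n (f : ℕ → ℕ → X → Carrier) →
            ∑₂ n (λ a b → T (f a b)) ≈ T (λ y → ∑₂ n (λ a b → f a b y))
  ∑₂-swap T T-+ zero    f = refl
  ∑₂-swap T T-+ (suc n) f = trans (+-congˡ (∑₂-swap T T-+ n (λ a b → f (suc a) b))) (sym (T-+ _ _))

  ∑₂-snoc : ∀ n f → ∑₂ (suc n) f ≈ ∑₂ n (λ a b → f a (suc b)) + f (suc n) 0
  ∑₂-snoc zero    f = refl
  ∑₂-snoc (suc n) f = trans (+-congˡ (∑₂-snoc n (λ a b → f (suc a) b))) (sym (+-assoc _ _ _))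

  ∑₂-comm : ∀ n f → ∑₂ n f ≈ ∑₂ n (λ a b → f b a)
  ∑₂-comm zero    f = refl
  ∑₂-comm (suc n) f = begin
    f 0 (suc n) + ∑₂ n (λ a b → f (suc a) b) ≈⟨ +-comm _ _ ⟩
    ∑₂ n (λ a b → f (suc a) b) + f 0 (suc n) ≈⟨ +-congʳ (∑₂-comm n (λ a b → f (suc a) b)) ⟩
    ∑₂ n (λ a b → f (suc b) a) + f 0 (suc n) ≈⟨ ∑₂-snoc n (λ a b → f b a) ⟨
    ∑₂ (suc n) (λ a b → f b a)               ∎

  ∑₂ᵛ-comm : ∀ {k} (i : MultiIndex k) f → ∑₂ᵛ i f ≈ ∑₂ᵛ i (λ j l → f l j)
  ∑₂ᵛ-comm []       f = refl
  ∑₂ᵛ-comm (n ∷ ns) f = trans (∑₂-comm n _) (∑₂-cong n (λ a b _ → ∑₂ᵛ-comm ns _))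

  -- Both sides run over the triples b + e + d = n. The terms with b = 0 agree, and the others form
  -- the same identity for n - 1 with b shifted by one.
  ∑₂-assoc : ∀ n (h : ℕ → ℕ → ℕ → Carrier) →
             ∑₂ n (λ a d → ∑₂ a (λ b e → h b e d)) ≈ ∑₂ n (λ b a → ∑₂ a (λ e d → h b e d))
  ∑₂-assoc zero    h = refl
  ∑₂-assoc (suc n) h = begin
    h 0 0 (suc n) + ∑₂ n (λ a d → h 0 (suc a) d + ∑₂ a (λ b e → h (suc b) e d))
      ≈⟨ +-congˡ (∑₂-+ n _ _) ⟩
    h 0 0 (suc n) + (∑₂ n (λ a d → h 0 (suc a) d) + ∑₂ n (λ a d → ∑₂ a (λ b e → h (suc b) e d)))
      ≈⟨ +-assoc _ _ _ ⟨
    ∑₂ (suc n) (h 0) + ∑₂ n (λ a d → ∑₂ a (λ b e → h (suc b) e d))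
      ≈⟨ +-congˡ (∑₂-assoc n (λ b e d → h (suc b) e d)) ⟩
    ∑₂ (suc n) (λ b a → ∑₂ a (λ e d → h b e d)) ∎

  -- The sums over heads and over tails are interleaved. A swap brings the two head sums together,
  -- associativity then applies to the heads and inductively to the tails, and a second swap
  -- restores the interleaving.
  ∑₂ᵛ-assoc : ∀ {k} (i : MultiIndex k) (h : MultiIndex k → MultiIndex k → MultiIndex k → Carrier) →
    ∑₂ᵛ i (λ a d → ∑₂ᵛ a (λ b e → h b e d)) ≈ ∑₂ᵛ i (λ b a → ∑₂ᵛ a (λ e d → h b e d))
  ∑₂ᵛ-assoc []       h = refl
  ∑₂ᵛ-assoc (n ∷ ns) h = begin
    ∑₂ n (λ a d → ∑₂ᵛ ns (λ as ds → ∑₂ a (λ b e → ∑₂ᵛ as (λ bs es → H b e d bs es ds))))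
      ≈⟨ ∑₂-cong n (λ a d _ → sym (∑₂-swap (λ g → ∑₂ᵛ ns (λ as ds → g (as , ds))) (λ _ _ → ∑₂ᵛ-+ ns _ _) a
           (λ b e (as , ds) → ∑₂ᵛ as (λ bs es → H b e d bs es ds)))) ⟩
    ∑₂ n (λ a d → ∑₂ a (λ b e → ∑₂ᵛ ns (λ as ds → ∑₂ᵛ as (λ bs es → H b e d bs es ds))))
      ≈⟨ ∑₂-assoc n (λ b e d → ∑₂ᵛ ns (λ as ds → ∑₂ᵛ as (λ bs es → H b e d bs es ds))) ⟩
    ∑₂ n (λ b a → ∑₂ a (λ e d → ∑₂ᵛ ns (λ as ds → ∑₂ᵛ as (λ bs es → H b e d bs es ds))))
      ≈⟨ ∑₂-cong n (λ b a _ → ∑₂-cong a (λ e d _ → ∑₂ᵛ-assoc ns (H b e d))) ⟩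
    ∑₂ n (λ b a → ∑₂ a (λ e d → ∑₂ᵛ ns (λ bs as → ∑₂ᵛ as (λ es ds → H b e d bs es ds))))
      ≈⟨ ∑₂-cong n (λ b a _ → ∑₂-swap (λ g → ∑₂ᵛ ns (λ bs as → g (bs , as))) (λ _ _ → ∑₂ᵛ-+ ns _ _) a
           (λ e d (bs , as) → ∑₂ᵛ as (λ es ds → H b e d bs es ds))) ⟩
    ∑₂ n (λ b a → ∑₂ᵛ ns (λ bs as → ∑₂ a (λ e d → ∑₂ᵛ as (λ es ds → H b e d bs es ds)))) ∎
    where
    H = λ b e d bs es ds → h (b ∷ bs) (e ∷ es) (d ∷ ds)

  ∑-upTo : ∀ n f → ∑ (upTo (suc n)) (λ a → f a (n ∸ a)) ≈ ∑₂ n f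
  ∑-upTo zero    f = +-identityʳ _
  ∑-upTo (suc n) f = +-congˡ (begin
    ∑ (List.applyUpTo suc (suc n)) (λ a → f a (suc n ∸ a))
      ≡⟨ ≡.cong (λ xs → ∑ xs (λ a → f a (suc n ∸ a))) (map-upTo suc (suc n)) ⟨
    ∑ (List.map suc (upTo (suc n))) (λ a → f a (suc n ∸ a))
      ≡⟨ ∑-map suc (upTo (suc n)) _ ⟩
    ∑ (upTo (suc n)) (λ a → f (suc a) (n ∸ a))
      ≈⟨ ∑-upTo n _ ⟩
    ∑₂ n (λ a b → f (suc a) b) ∎)

  ∑-box : ∀ {k} (i : MultiIndex k) f → ∑ (box i) (λ j → f j (zipWith _∸_ i j)) ≈ ∑₂ᵛ i f
  ∑-box []       f = +-identityʳ _
  ∑-box (n ∷ ns) f = begin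
    ∑ (box (n ∷ ns)) (λ j → f j (zipWith _∸_ (n ∷ ns) j))
      ≈⟨ ∑-cartesianProductWith _∷_ (upTo (suc n)) (box ns) _ ⟩
    ∑ (upTo (suc n)) (λ a → ∑ (box ns) (λ as → f (a ∷ as) (n ∸ a ∷ zipWith _∸_ ns as)))
      ≈⟨ ∑-cong (upTo (suc n)) (λ a → ∑-box ns (λ as bs → f (a ∷ as) (n ∸ a ∷ bs))) ⟩
    ∑ (upTo (suc n)) (λ a → ∑₂ᵛ ns (λ as bs → f (a ∷ as) (n ∸ a ∷ bs)))
      ≈⟨ ∑-upTo n _ ⟩
    ∑₂ᵛ (n ∷ ns) f ∎

  -- Σ_{|j| = l} f j
  ∑ᵈ : ∀ n → ℕ → (MultiIndex n → Carrier) → Carrier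
  ∑ᵈ zero    zero    f = f []
  ∑ᵈ zero    (suc l) f = 0#
  ∑ᵈ (suc n) l       f = ∑₂ l (λ a b → ∑ᵈ n b (λ j → f (a ∷ j)))

  ∑ᵈ-cong : ∀ n l {f g} → (∀ j → f j ≈ g j) → ∑ᵈ n l f ≈ ∑ᵈ n l g
  ∑ᵈ-cong zero    zero    f≈g = f≈g []
  ∑ᵈ-cong zero    (suc l) f≈g = refl
  ∑ᵈ-cong (suc n) l       f≈g = ∑₂-cong l (λ a b _ → ∑ᵈ-cong n b (λ j → f≈g (a ∷ j)))

  ∑ᵈ-0 : ∀ n l {f} → (∀ j → f j ≈ 0#) → ∑ᵈ n l f ≈ 0#
  ∑ᵈ-0 zero    zero    f≈0 = f≈0 []
  ∑ᵈ-0 zero    (suc l) f≈0 = refl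
  ∑ᵈ-0 (suc n) l       f≈0 = ∑₂-0 l (λ a b _ → ∑ᵈ-0 n b (λ j → f≈0 (a ∷ j)))

  ∑ᵈ-* : ∀ n l x f → x * ∑ᵈ n l f ≈ ∑ᵈ n l (λ j → x * f j)
  ∑ᵈ-* zero    zero    x f = refl
  ∑ᵈ-* zero    (suc l) x f = zeroʳ x
  ∑ᵈ-* (suc n) l       x f = trans (∑₂-* l x _) (∑₂-cong l (λ a b _ → ∑ᵈ-* n b x _))

  -- With its second index ignored, `∑₂ n` is the plain sum over 0 ≤ a ≤ n; sums over a degree l
  -- take this form below.
  ∑₂-truncate : ∀ m n {f : ℕ → Carrier} → (∀ a → n ℕ.< a → f a ≈ 0#) →
                ∑₂ (m ℕ.+ n) (λ a _ → f a) ≈ ∑₂ n (λ a _ → f a)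
  ∑₂-truncate zero    n f≈0 = refl
  ∑₂-truncate (suc m) n {f} f≈0 = begin
    ∑₂ (suc (m ℕ.+ n)) (λ a _ → f a)                ≈⟨ ∑₂-snoc (m ℕ.+ n) (λ a _ → f a) ⟩
    ∑₂ (m ℕ.+ n) (λ a _ → f a) + f (suc m ℕ.+ n)    ≈⟨ +-cong (∑₂-truncate m n f≈0)
                                                         (f≈0 _ (ℕ.s≤s (ℕ.m≤n+m n m))) ⟩
    ∑₂ n (λ a _ → f a) + 0#                         ≈⟨ +-identityʳ _ ⟩
    ∑₂ n (λ a _ → f a)                              ∎

  -- The cube contains every j with ∣ j ∣ ≤ N, and the hypothesis discards the rest of it. The
  -- degree is an argument of `f` separate from j so that the induction, having fixed the first
  -- entry a, can pass to `λ b j → f (a ℕ.+ b) (a ∷ j)`.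
  ∑-cube : ∀ n N (f : ℕ → MultiIndex n → Carrier) → (∀ l j → N ℕ.< l → f l j ≈ 0#) →
           ∑ (box (replicate n N)) (λ j → f ∣ j ∣ j) ≈ ∑₂ N (λ l _ → ∑ᵈ n l (f l))
  ∑-cube zero    N f f≈0 = trans (+-identityʳ _) (sym (∑₂-single N 0 N ≡.refl vanish))
    where
    vanish : ∀ a b → a ℕ.+ b ≡ N → a ≢ 0 → ∑ᵈ zero a (f a) ≈ 0#
    vanish zero    _ _ 0≢0 = contradiction ≡.refl 0≢0
    vanish (suc a) _ _ _   = refl
  ∑-cube (suc n) N f f≈0 = begin
    ∑ (box (replicate (suc n) N)) (λ j → f ∣ j ∣ j)
      ≈⟨ ∑-cartesianProductWith _∷_ (upTo (suc N)) (box (replicate n N)) _ ⟩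
    ∑ (upTo (suc N)) (λ a → ∑ (box (replicate n N)) (λ j → f (a ℕ.+ ∣ j ∣) (a ∷ j)))
      ≈⟨ ∑-cong (upTo (suc N)) (λ a → ∑-cube n N (λ b j → f (a ℕ.+ b) (a ∷ j))
           (λ b j N<b → f≈0 (a ℕ.+ b) (a ∷ j) (ℕ.<-≤-trans N<b (ℕ.m≤n+m b a)))) ⟩
    ∑ (upTo (suc N)) (λ a → ∑₂ N (λ b _ → g a b))
      ≈⟨ ∑-upTo N (λ a _ → ∑₂ N (λ b _ → g a b)) ⟩
    ∑₂ N (λ a _ → ∑₂ N (λ b _ → g a b))
      -- The square a, b ≤ N shrinks to the triangle a + b ≤ N, which `∑₂-assoc` regroups by the
      -- degree l = a + b.
      ≈⟨ ∑₂-cong N cut ⟩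
    ∑₂ N (λ a d → ∑₂ d (λ b _ → g a b))
      ≈⟨ ∑₂-assoc N (λ a b _ → g a b) ⟨
    ∑₂ N (λ l _ → ∑₂ l (λ a b → g a b))
      ≈⟨ ∑₂-cong N (λ l _ _ → ∑₂-cong l (λ { a b ≡.refl → refl })) ⟩
    ∑₂ N (λ l _ → ∑ᵈ (suc n) l (f l)) ∎
    where
    g : ℕ → ℕ → Carrier
    g = λ a b → ∑ᵈ n b (λ j → f (a ℕ.+ b) (a ∷ j))
    cut : ∀ a d → a ℕ.+ d ≡ N → ∑₂ N (λ b _ → g a b) ≈ ∑₂ d (λ b _ → g a b)
    cut a d ≡.refl = ∑₂-truncate a d (λ b d<b → ∑ᵈ-0 n b (λ j → f≈0 _ _ (ℕ.+-monoʳ-< a d<b)))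

-- Divided powers and the multinomial theorem

module DividedPowers {c ℓ} (S : CommutativeSemiring c ℓ) where
  open CommutativeSemiring S hiding (zero)
  open import Relation.Binary.Reasoning.Setoid setoid
  open import Algebra.Properties.CommutativeSemigroup *-commutativeSemigroup
    using (interchange; x∙yz≈y∙xz)
  open import Algebra.Properties.Semiring.Mult semiring using (×-homo-+; ×1-homo-*) renaming (_×_ to _·_)
  open import Algebra.Properties.Semiring.Exp semiring using (_^_)
  open Sums S

  ⌜_⌝ : ℕ → Carrier
  ⌜ n ⌝ = n · 1#

  module Divisible
    (inv : ∀ n → .{{NonZero n}} → Carrier)
    (inverseˡ : ∀ n .{{_ : NonZero n}} → inv n * ⌜ n ⌝ ≈ 1#)
    where

    inv-cong : ∀ {m n} .{{_ : NonZero m}} .{{_ : NonZero n}} → m ≡ n → inv m ≈ inv n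
    inv-cong ≡.refl = refl

    ⌜⌝-cancelˡ : ∀ n .{{_ : NonZero n}} {x y} → ⌜ n ⌝ * x ≈ ⌜ n ⌝ * y → x ≈ y
    ⌜⌝-cancelˡ n {x} {y} eq = begin
      x                    ≈⟨ expand x ⟩
      inv n * (⌜ n ⌝ * x)  ≈⟨ *-congˡ eq ⟩
      inv n * (⌜ n ⌝ * y)  ≈⟨ expand y ⟨
      y                    ∎
      where
      expand : ∀ z → z ≈ inv n * (⌜ n ⌝ * z)
      expand z = begin
        z                    ≈⟨ *-identityˡ z ⟨
        1# * z               ≈⟨ *-congʳ (inverseˡ n) ⟨
        inv n * ⌜ n ⌝ * z    ≈⟨ *-assoc _ _ _ ⟩
        inv n * (⌜ n ⌝ * z)  ∎

    inverseʳ : ∀ n .{{_ : NonZero n}} → ⌜ n ⌝ * inv n ≈ 1#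
    inverseʳ n = trans (*-comm _ _) (inverseˡ n)

    inv-* : ∀ m n .{{_ : NonZero m}} .{{_ : NonZero n}} .{{_ : NonZero (m ℕ.* n)}} →
            inv (m ℕ.* n) ≈ inv m * inv n
    inv-* m n = ⌜⌝-cancelˡ (m ℕ.* n) (begin
      ⌜ m ℕ.* n ⌝ * inv (m ℕ.* n)         ≈⟨ inverseʳ (m ℕ.* n) ⟩
      1#                                  ≈⟨ *-identityˡ 1# ⟨
      1# * 1#                             ≈⟨ *-cong (inverseʳ m) (inverseʳ n) ⟨
      ⌜ m ⌝ * inv m * (⌜ n ⌝ * inv n)     ≈⟨ interchange _ _ _ _ ⟩
      ⌜ m ⌝ * ⌜ n ⌝ * (inv m * inv n)     ≈⟨ *-congʳ (×1-homo-* m n) ⟨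
      ⌜ m ℕ.* n ⌝ * (inv m * inv n)       ∎)

    inv-1 : inv 1 ≈ 1#
    inv-1 = begin
      inv 1          ≈⟨ *-identityʳ _ ⟨
      inv 1 * 1#     ≈⟨ *-congˡ (+-identityʳ 1#) ⟨
      inv 1 * ⌜ 1 ⌝  ≈⟨ inverseˡ 1 ⟩
      1#             ∎

    infix 9 _!⁻¹
    _!⁻¹ : ℕ → Carrier
    n !⁻¹ = inv (n !) {{ℕ._!≢0 n}}

    infixr 8 _^[_]
    -- In this normalisation the binomial coefficient n!/(a! b!) is absorbed by the factors, which
    -- lets `^[]-+` be iterated without bookkeeping.
    _^[_] : Carrier → ℕ → Carrier
    x ^[ n ] = n !⁻¹ * x ^ n

    ^[0] : ∀ x → x ^[ 0 ] ≈ 1#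
    ^[0] x = trans (*-identityʳ _) inv-1

    ^[suc] : ∀ x n → ⌜ suc n ⌝ * x ^[ suc n ] ≈ x * x ^[ n ]
    ^[suc] x n = begin
      ⌜ suc n ⌝ * (suc n !⁻¹ * (x * x ^ n))
        ≈⟨ *-congˡ (*-congʳ (inv-* (suc n) (n !) {{_}} {{ℕ._!≢0 n}} {{ℕ._!≢0 (suc n)}})) ⟩
      ⌜ suc n ⌝ * (inv (suc n) * n !⁻¹ * (x * x ^ n))
        ≈⟨ *-congˡ (*-assoc _ _ _) ⟩
      ⌜ suc n ⌝ * (inv (suc n) * (n !⁻¹ * (x * x ^ n)))
        ≈⟨ *-assoc _ _ _ ⟨
      ⌜ suc n ⌝ * inv (suc n) * (n !⁻¹ * (x * x ^ n))
        ≈⟨ *-congʳ (inverseʳ (suc n)) ⟩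
      1# * (n !⁻¹ * (x * x ^ n))
        ≈⟨ *-identityˡ _ ⟩
      n !⁻¹ * (x * x ^ n)
        ≈⟨ x∙yz≈y∙xz _ _ _ ⟩
      x * x ^[ n ] ∎

    ^[]-0 : ∀ n → 0# ^[ suc n ] ≈ 0#
    ^[]-0 n = trans (*-congˡ (zeroˡ _)) (zeroʳ _)

    -- Multiplying by n = a + b splits each summand in two; in either half
    -- the factor a or b lowers a divided power by one.
    ^[]-+ : ∀ n x y → (x + y) ^[ n ] ≈ ∑₂ n (λ a b → x ^[ a ] * y ^[ b ])
    ^[]-+ zero    x y = begin
      (x + y) ^[ 0 ]        ≈⟨ ^[0] (x + y) ⟩
      1#                    ≈⟨ *-identityˡ 1# ⟨
      1# * 1#               ≈⟨ *-cong (^[0] x) (^[0] y) ⟨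
      x ^[ 0 ] * y ^[ 0 ]   ∎
    ^[]-+ (suc n) x y = ⌜⌝-cancelˡ (suc n) (begin
      ⌜ suc n ⌝ * (x + y) ^[ suc n ]
        ≈⟨ ^[suc] (x + y) n ⟩
      (x + y) * (x + y) ^[ n ]
        ≈⟨ *-congˡ (^[]-+ n x y) ⟩
      (x + y) * ∑₂ n F
        ≈⟨ distribʳ _ _ _ ⟩
      x * ∑₂ n F + y * ∑₂ n F
        ≈⟨ +-cong (∑₂-* n x F) (∑₂-* n y F) ⟩
      ∑₂ n (λ a b → x * F a b) + ∑₂ n (λ a b → y * F a b)
        ≈⟨ +-cong (∑₂-cong n (λ a b _ → lower-x a b)) (∑₂-cong n (λ a b _ → lower-y a b)) ⟨
      ∑₂ n (λ a b → ⌜ suc a ⌝ * F (suc a) b) + ∑₂ n (λ a b → ⌜ suc b ⌝ * F a (suc b))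
        ≈⟨ +-cong (+-identityˡ _) (+-identityʳ _) ⟨
      (0# + ∑₂ n (λ a b → ⌜ suc a ⌝ * F (suc a) b)) + (∑₂ n (λ a b → ⌜ suc b ⌝ * F a (suc b)) + 0#)
        ≈⟨ +-cong (+-congʳ (zeroˡ _)) (+-congˡ (zeroˡ _)) ⟨
      ∑₂ (suc n) (λ a b → ⌜ a ⌝ * F a b) + (∑₂ n (λ a b → ⌜ suc b ⌝ * F a (suc b)) + ⌜ 0 ⌝ * F (suc n) 0)
        ≈⟨ +-congˡ (∑₂-snoc n (λ a b → ⌜ b ⌝ * F a b)) ⟨
      ∑₂ (suc n) (λ a b → ⌜ a ⌝ * F a b) + ∑₂ (suc n) (λ a b → ⌜ b ⌝ * F a b)
        ≈⟨ ∑₂-+ (suc n) (λ a b → ⌜ a ⌝ * F a b) (λ a b → ⌜ b ⌝ * F a b) ⟨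
      ∑₂ (suc n) (λ a b → ⌜ a ⌝ * F a b + ⌜ b ⌝ * F a b)
        ≈⟨ ∑₂-cong (suc n) split ⟨
      ∑₂ (suc n) (λ a b → ⌜ suc n ⌝ * F a b)
        ≈⟨ ∑₂-* (suc n) ⌜ suc n ⌝ F ⟨
      ⌜ suc n ⌝ * ∑₂ (suc n) F ∎)
      where
      F : ℕ → ℕ → Carrier
      F a b = x ^[ a ] * y ^[ b ]

      lower-x : ∀ a b → ⌜ suc a ⌝ * F (suc a) b ≈ x * F a b
      lower-x a b = trans (sym (*-assoc _ _ _)) (trans (*-congʳ (^[suc] x a)) (*-assoc _ _ _))

      lower-y : ∀ a b → ⌜ suc b ⌝ * F a (suc b) ≈ y * F a b
      lower-y a b = trans (x∙yz≈y∙xz _ _ _) (trans (*-congˡ (^[suc] y b)) (x∙yz≈y∙xz _ _ _))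

      split : ∀ a b → a ℕ.+ b ≡ suc n → ⌜ suc n ⌝ * F a b ≈ ⌜ a ⌝ * F a b + ⌜ b ⌝ * F a b
      split a b eq = begin
        ⌜ suc n ⌝ * F a b              ≡⟨ ≡.cong (λ k → ⌜ k ⌝ * F a b) eq ⟨
        ⌜ a ℕ.+ b ⌝ * F a b            ≈⟨ *-congʳ (×-homo-+ 1# a b) ⟩
        (⌜ a ⌝ + ⌜ b ⌝) * F a b        ≈⟨ distribʳ _ _ _ ⟩
        ⌜ a ⌝ * F a b + ⌜ b ⌝ * F a b  ∎

    _^[_]ᵛ : ∀ {n} → Vec Carrier n → MultiIndex n → Carrier
    []       ^[ []     ]ᵛ = 1#
    (x ∷ xs) ^[ j ∷ js ]ᵛ = x ^[ j ] * xs ^[ js ]ᵛ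

    -- Iterated `^[]-+`. In the base case the empty sum is 0, whose divided powers of positive
    -- degree vanish just as `∑ᵈ zero (suc l)` does.
    multinomial : ∀ {n} (xs : Vec Carrier n) l →
                  Vec.foldr _ _+_ 0# xs ^[ l ] ≈ ∑ᵈ n l (xs ^[_]ᵛ)
    multinomial []       zero    = ^[0] 0#
    multinomial []       (suc l) = ^[]-0 l
    multinomial {suc n} (x ∷ xs) l = begin
      (x + Vec.foldr _ _+_ 0# xs) ^[ l ]
        ≈⟨ ^[]-+ l x _ ⟩
      ∑₂ l (λ a b → x ^[ a ] * Vec.foldr _ _+_ 0# xs ^[ b ])
        ≈⟨ ∑₂-cong l (λ a b _ → *-congˡ (multinomial xs b)) ⟩
      ∑₂ l (λ a b → x ^[ a ] * ∑ᵈ n b (xs ^[_]ᵛ))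
        ≈⟨ ∑₂-cong l (λ a b _ → ∑ᵈ-* n b _ _) ⟩
      ∑ᵈ (suc n) l ((x ∷ xs) ^[_]ᵛ) ∎

-- Words and the multiplicities of their letters

lists-All : ∀ {b p} {B : Set b} {P : B → Set p} {xs : List B} → All P xs →
            ∀ l → All (λ w → List.length w ≡ l × All P w) (lists xs l)
lists-All pxs zero    = (≡.refl , []) ∷ []
lists-All {P = P} {xs} pxs (suc l) = extend pxs
  where
  extend : ∀ {ys} → All P ys →
           All (λ w → List.length w ≡ suc l × All P w) (List.cartesianProductWith _∷_ ys (lists xs l))
  extend []         = []
  extend (py ∷ pys) = All.++⁺
    (All.map⁺ (All.map (λ (eq , pw) → ≡.cong suc eq , py ∷ pw) (lists-All pxs l)))
    (extend pys)

module _ {m : ℕ} where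

  deduplicate-All : ∀ {p} {P : Vec ℕ m → Set p} {w} → All P w → All P (deduplicate _≟_ w)
  deduplicate-All []         = []
  deduplicate-All {w = x ∷ _} (px ∷ pw) = px ∷ All.filter⁺ (¬? ∘ (x ≟_)) (deduplicate-All pw)

  deduplicate-replicate : ∀ a (x : Vec ℕ m) {w} → All (x ≢_) w →
    deduplicate _≟_ (List.replicate (suc a) x ++ w) ≡ x ∷ deduplicate _≟_ w
  deduplicate-replicate zero    x x∉w =
    ≡.cong (x ∷_) (filter-all (¬? ∘ (x ≟_)) (deduplicate-All x∉w))
  deduplicate-replicate (suc a) x {w} x∉w = ≡.cong (x ∷_) (begin
    filter (¬? ∘ (x ≟_)) (deduplicate _≟_ (List.replicate (suc a) x ++ w))
      ≡⟨ ≡.cong (filter (¬? ∘ (x ≟_))) (deduplicate-replicate a x x∉w) ⟩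
    filter (¬? ∘ (x ≟_)) (x ∷ deduplicate _≟_ w)
      ≡⟨ filter-reject (¬? ∘ (x ≟_)) (λ x≢x → x≢x ≡.refl) ⟩
    filter (¬? ∘ (x ≟_)) (deduplicate _≟_ w)
      ≡⟨ filter-all (¬? ∘ (x ≟_)) (deduplicate-All x∉w) ⟩
    deduplicate _≟_ w ∎)
    where open ≡.≡-Reasoning

  multiplicity-self : ∀ a (x : Vec ℕ m) {w} → All (x ≢_) w →
                      multiplicity x (List.replicate a x ++ w) ≡ a
  multiplicity-self zero    x x∉w = ≡.cong List.length (filter-none (x ≟_) x∉w)
  multiplicity-self (suc a) x x∉w = ≡.trans
    (≡.cong List.length (filter-accept (x ≟_) ≡.refl)) (≡.cong suc (multiplicity-self a x x∉w))

  multiplicity-other : ∀ a {x v : Vec ℕ m} {w} → x ≢ v →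
                       multiplicity v (List.replicate a x ++ w) ≡ multiplicity v w
  multiplicity-other zero    x≢v = ≡.refl
  multiplicity-other (suc a) {x} {v} x≢v = ≡.trans
    (≡.cong List.length (filter-reject (v ≟_) (x≢v ∘ ≡.sym))) (multiplicity-other a x≢v)

  -- As x is foreign to w, it adds one distinct letter, of multiplicity a, and leaves the other
  -- multiplicities alone. For a = 0 it is no letter of the word at all, and the formula survives
  -- because 0! = 1.
  𝔪-replicate : ∀ a (x : Vec ℕ m) {w} → All (x ≢_) w →
                (𝔪 (List.replicate a x ++ w) !) ≡ (a !) ℕ.* (𝔪 w !)
  𝔪-replicate zero    x {w} x∉w = ≡.sym (ℕ.*-identityˡ (𝔪 w !))
  𝔪-replicate (suc a) x {w} x∉w = begin
    product (List.map (λ v → multiplicity v u !) (deduplicate _≟_ u))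
      ≡⟨ ≡.cong (λ d → product (List.map (λ v → multiplicity v u !) d)) (deduplicate-replicate a x x∉w) ⟩
    multiplicity x u ! ℕ.* product (List.map (λ v → multiplicity v u !) (deduplicate _≟_ w))
      ≡⟨ ≡.cong₂ ℕ._*_ (≡.cong _! (multiplicity-self (suc a) x x∉w))
           (≡.cong product (map-cong-local (All.map (λ x≢v → ≡.cong _! (multiplicity-other (suc a) x≢v))
             (deduplicate-All x∉w)))) ⟩
    (suc a !) ℕ.* (𝔪 w !) ∎
    where
    open ≡.≡-Reasoning
    u = List.replicate (suc a) x ++ w

𝔪!≢0 : ∀ {m} (w : Matrix m) → NonZero (𝔪 w !)
𝔪!≢0 w = product-map≢0 _ (λ v → ℕ._!≢0 (multiplicity v w)) (deduplicate _≟_ w)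

-- Sums over sorted words

module _ {m : ℕ} where
  open TotalOrder (lex m) using (_≤_) renaming (trans to ≤-trans; refl to ≤-refl)

  sorted? : (w : Matrix m) → Dec (Linked _≤_ w)
  sorted? = linked? (Lex.≤-dec ℕ._≟_ ℕ._≤?_)

  infix 4 _≺_
  -- The two halves serve separately: x ≤ y keeps a word sorted when x is put in front, and ¬ (y ≤
  -- x) forbids x anywhere after y.
  _≺_ : Vec ℕ m → Vec ℕ m → Set
  x ≺ y = x ≤ y × ¬ (y ≤ x)

  ≺⇒≢ : ∀ {x y} → x ≺ y → x ≢ y
  ≺⇒≢ (_ , y≰x) ≡.refl = y≰x ≤-refl

  sorted-∷ : ∀ {x} {w : Matrix m} → All (x ≤_) w → Linked _≤_ w → Linked _≤_ (x ∷ w)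
  sorted-∷ []        []        = [-]
  sorted-∷ (x≤y ∷ _) [-]       = x≤y ∷ [-]
  sorted-∷ (x≤y ∷ _) (r ∷ rs)  = x≤y ∷ r ∷ rs

  sorted-∷⁻ : ∀ {x} {w : Matrix m} → Linked _≤_ (x ∷ w) → All (x ≤_) w
  sorted-∷⁻ [-]      = []
  sorted-∷⁻ (r ∷ rs) = Linked⇒All ≤-trans r rs

module SortedWords {c ℓ} (S : CommutativeSemiring c ℓ) (m : ℕ) where
  open TotalOrder (lex m) using (_≤_) renaming (refl to ≤-refl)
  open CommutativeSemiring S hiding (zero)
  open import Relation.Binary.Reasoning.Setoid setoid
  open import Algebra.Properties.CommutativeSemigroup *-commutativeSemigroup using (interchange)
  open import Algebra.Properties.Semiring.Exp semiring using (_^_)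
  open Sums S
  open DividedPowers S using (⌜_⌝; module Divisible)
  -- A word that contains x has the form u ++ x ∷ v. The prefix u is arbitrary in the hypothesis so
  -- that the induction can move the first letter y into `f`.
  drop-letter : ∀ x xs l {f : Matrix m → Carrier} → (∀ u v → f (u ++ x ∷ v) ≈ 0#) →
                ∑ (lists (x ∷ xs) l) f ≈ ∑ (lists xs l) f
  drop-letter x xs zero    f≈0 = refl
  drop-letter x xs (suc l) {f} f≈0 = begin
    ∑ (lists (x ∷ xs) (suc l)) f
      ≈⟨ ∑-cartesianProductWith _∷_ (x ∷ xs) (lists (x ∷ xs) l) f ⟩
    ∑ (lists (x ∷ xs) l) (λ w → f (x ∷ w)) + ∑ xs (λ y → ∑ (lists (x ∷ xs) l) (λ w → f (y ∷ w)))
      ≈⟨ +-cong (∑-0 (lists (x ∷ xs) l) (f≈0 []))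
           (∑-cong xs (λ y → drop-letter x xs l (λ u → f≈0 (y ∷ u)))) ⟩
    0# + ∑ xs (λ y → ∑ (lists xs l) (λ w → f (y ∷ w)))
      ≈⟨ +-identityˡ _ ⟩
    ∑ xs (λ y → ∑ (lists xs l) (λ w → f (y ∷ w)))
      ≈⟨ ∑-cartesianProductWith _∷_ xs (lists xs l) f ⟨
    ∑ (lists xs (suc l)) f ∎

  -- A sorted word over x ∷ xs, with x below all of xs, is a power of x
  -- followed by a sorted word over xs.
  ∑-sorted-∷ : ∀ {x xs} → All (x ≺_) xs → ∀ l (f : Matrix m → Carrier) →
    ∑ (lists (x ∷ xs) l) (λ w → when (sorted? w) (f w))
      ≈ ∑₂ l (λ a b → ∑ (lists xs b) (λ w → when (sorted? w) (f (List.replicate a x ++ w))))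
  ∑-sorted-∷ x≺xs zero f = refl
  ∑-sorted-∷ {x} {xs} x≺xs (suc l) f = begin
    ∑ (lists (x ∷ xs) (suc l)) (λ w → when (sorted? w) (f w))
      ≈⟨ ∑-cartesianProductWith _∷_ (x ∷ xs) ws _ ⟩
    ∑ ws (λ w → when (sorted? (x ∷ w)) (f (x ∷ w)))
      + ∑ xs (λ y → ∑ ws (λ w → when (sorted? (y ∷ w)) (f (y ∷ w))))
      ≈⟨ +-cong starts-with-x (∑-congᴬ (All.map (λ x≺y → drop-letter x xs l (later-x x≺y)) x≺xs)) ⟩
    ∑ ws (λ w → when (sorted? w) (f (x ∷ w)))
      + ∑ xs (λ y → ∑ (lists xs l) (λ w → when (sorted? (y ∷ w)) (f (y ∷ w))))
      ≈⟨ +-cong (∑-sorted-∷ x≺xs l (f ∘ (x ∷_))) (sym (∑-cartesianProductWith _∷_ xs (lists xs l) _)) ⟩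
    ∑₂ l (λ a b → G (suc a) b) + G 0 (suc l)
      ≈⟨ +-comm _ _ ⟩
    ∑₂ (suc l) G ∎
    where
    ws = lists (x ∷ xs) l

    G : ℕ → ℕ → Carrier
    G a b = ∑ (lists xs b) (λ w → when (sorted? w) (f (List.replicate a x ++ w)))

    starts-with-x : ∑ ws (λ w → when (sorted? (x ∷ w)) (f (x ∷ w)))
                      ≈ ∑ ws (λ w → when (sorted? w) (f (x ∷ w)))
    starts-with-x = ∑-congᴬ (All.map
      (λ {w} (_ , x≤w) → when-⇔ (sorted? (x ∷ w)) (sorted? w) Linked.tail (sorted-∷ x≤w))
      (lists-All (≤-refl ∷ All.map proj₁ x≺xs) l))

    later-x : ∀ {y} → x ≺ y → ∀ u v → when (sorted? (y ∷ u ++ x ∷ v)) (f (y ∷ u ++ x ∷ v)) ≈ 0#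
    later-x {y} (_ , y≰x) u v = when-no (sorted? (y ∷ u ++ x ∷ v))
      (λ s → y≰x (All.head (All.++⁻ʳ u (sorted-∷⁻ s))))

  ∏-replicate : ∀ a (x : Vec ℕ m) {w} f → ∏ (List.replicate a x ++ w) f ≈ f x ^ a * ∏ w f
  ∏-replicate zero    x f = sym (*-identityˡ _)
  ∏-replicate (suc a) x f = trans (*-congˡ (∏-replicate a x f)) (sym (*-assoc _ _ _))

  module _
    (inv : ∀ n → .{{NonZero n}} → Carrier)
    (inverseˡ : ∀ n .{{_ : NonZero n}} → inv n * ⌜ n ⌝ ≈ 1#)
    where

    open Divisible inv inverseˡ

    -- In the application S consists of power series and the value of a letter v is the monomial gᵥ
    -- tᵛ. The induction closes because the weight of xᵃ w is `f x ^[ a ]` times the weight of w, so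
    -- that the split by `∑-sorted-∷` is the right side of `^[]-+`.
    ∑-sorted : ∀ {xs} → AllPairs _≺_ xs → ∀ l (f : Vec ℕ m → Carrier) →
      ∑ (lists xs l) (λ w → when (sorted? w) (inv (𝔪 w !) {{𝔪!≢0 w}} * ∏ w f)) ≈ ∑ xs f ^[ l ]
    ∑-sorted [] zero    f = +-identityʳ _
    ∑-sorted [] (suc l) f = sym (^[]-0 l)
    ∑-sorted {x ∷ xs} (x≺xs ∷ ≺xs) l f = begin
      ∑ (lists (x ∷ xs) l) (λ w → when (sorted? w) (W w))
        ≈⟨ ∑-sorted-∷ x≺xs l W ⟩
      ∑₂ l (λ a b → ∑ (lists xs b) (λ w → when (sorted? w) (W (List.replicate a x ++ w))))
        ≈⟨ ∑₂-cong l (λ a b _ → ∑-congᴬ (All.map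
             (λ {w} (_ , x≺w) → trans
               (when-congʳ (sorted? w) (factor a w (All.map ≺⇒≢ x≺w)))
               (sym (*-when (sorted? w) _ _)))
             (lists-All x≺xs b))) ⟩
      ∑₂ l (λ a b → ∑ (lists xs b) (λ w → f x ^[ a ] * when (sorted? w) (W w)))
        ≈⟨ ∑₂-cong l (λ a b _ → ∑-* (lists xs b) (f x ^[ a ]) _) ⟨
      ∑₂ l (λ a b → f x ^[ a ] * ∑ (lists xs b) (λ w → when (sorted? w) (W w)))
        ≈⟨ ∑₂-cong l (λ a b _ → *-congˡ (∑-sorted ≺xs b f)) ⟩
      ∑₂ l (λ a b → f x ^[ a ] * ∑ xs f ^[ b ])
        ≈⟨ ^[]-+ l (f x) (∑ xs f) ⟨
      ∑ (x ∷ xs) f ^[ l ] ∎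
      where
      W : Matrix m → Carrier
      W w = inv (𝔪 w !) {{𝔪!≢0 w}} * ∏ w f

      factor : ∀ a w → All (x ≢_) w → W (List.replicate a x ++ w) ≈ f x ^[ a ] * W w
      factor a w x∉w = begin
        inv (𝔪 u !) {{𝔪!≢0 u}} * ∏ u f
          ≈⟨ *-cong (inv-cong {{𝔪!≢0 u}} {{a!𝔪w!≢0}} (𝔪-replicate a x x∉w)) (∏-replicate a x f) ⟩
        inv ((a !) ℕ.* (𝔪 w !)) {{a!𝔪w!≢0}} * (f x ^ a * ∏ w f)
          ≈⟨ *-congʳ (inv-* (a !) (𝔪 w !) {{ℕ._!≢0 a}} {{𝔪!≢0 w}} {{a!𝔪w!≢0}}) ⟩
        a !⁻¹ * inv (𝔪 w !) {{𝔪!≢0 w}} * (f x ^ a * ∏ w f)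
          ≈⟨ interchange _ _ _ _ ⟩
        f x ^[ a ] * W w ∎
        where
        u = List.replicate a x ++ w

        a!𝔪w!≢0 : NonZero ((a !) ℕ.* (𝔪 w !))
        a!𝔪w!≢0 = ℕ.m*n≢0 (a !) (𝔪 w !) {{ℕ._!≢0 a}} {{𝔪!≢0 w}}

-- Multi-indices and the lexicographic order of a box

∣∣-⊞ : ∀ {k} (i j : MultiIndex k) → ∣ i ⊞ j ∣ ≡ ∣ i ∣ ℕ.+ ∣ j ∣
∣∣-⊞ []       []       = ≡.refl
∣∣-⊞ (a ∷ as) (b ∷ bs) = ≡.trans (≡.cong (a ℕ.+ b ℕ.+_) (∣∣-⊞ as bs)) (interchange a b ∣ as ∣ ∣ bs ∣)
  where open CommutativeSemigroupProperties ℕ.+-commutativeSemigroup using (interchange)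

∣𝟎∣≡0 : ∀ k → ∣ 𝟎 {k} ∣ ≡ 0
∣𝟎∣≡0 zero    = ≡.refl
∣𝟎∣≡0 (suc k) = ∣𝟎∣≡0 k

∣∣≡0⇒≡𝟎 : ∀ {k} (i : MultiIndex k) → ∣ i ∣ ≡ 0 → i ≡ 𝟎
∣∣≡0⇒≡𝟎 []          _  = ≡.refl
∣∣≡0⇒≡𝟎 (zero ∷ as) eq = ≡.cong (0 ∷_) (∣∣≡0⇒≡𝟎 as eq)

⊞-identityˡ : ∀ {k} (i : MultiIndex k) → 𝟎 ⊞ i ≡ i
⊞-identityˡ = Vec.zipWith-identityˡ ℕ.+-identityˡ

⊞-assoc : ∀ {k} (i j l : MultiIndex k) → (i ⊞ j) ⊞ l ≡ i ⊞ (j ⊞ l)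
⊞-assoc = Vec.zipWith-assoc ℕ.+-assoc

⊞-comm : ∀ {k} (i j : MultiIndex k) → i ⊞ j ≡ j ⊞ i
⊞-comm = Vec.zipWith-comm ℕ.+-comm

≺-head : ∀ {m a b} {u v : Vec ℕ m} → a ℕ.< b → (a ∷ u) ≺ (b ∷ v)
≺-head a<b = Lex.this (ℕ.<⇒≤ a<b , ℕ.<⇒≢ a<b) ≡.refl , λ where
  (Lex.this (b≤a , _) _) → ℕ.<⇒≱ a<b b≤a
  (Lex.next b≡a _)       → ℕ.<⇒≢ a<b (≡.sym b≡a)

≺-tail : ∀ {m} a {u v : Vec ℕ m} → u ≺ v → (a ∷ u) ≺ (a ∷ v)
≺-tail a (u≤v , v≰u) = Lex.next ≡.refl u≤v , λ where
  (Lex.this (_ , a≢a) _) → a≢a ≡.refl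
  (Lex.next _ v≤u)       → v≰u v≤u

cartesianProductWith-∷-≺ : ∀ {m xs} {ys : List (Vec ℕ m)} → AllPairs ℕ._<_ xs → AllPairs _≺_ ys →
                           AllPairs _≺_ (cartesianProductWith _∷_ xs ys)
cartesianProductWith-∷-≺ []               ≺ys = []
cartesianProductWith-∷-≺ {xs = x ∷ xs} {ys} (x<xs ∷ <xs) ≺ys = AllPairs.++⁺
  (AllPairs.map⁺ (AllPairs.map (≺-tail x) ≺ys))
  (cartesianProductWith-∷-≺ <xs ≺ys)
  (All.map⁺ (All.universal (λ u → below u x<xs) ys))
  where
  below : ∀ u {zs} → All (x ℕ.<_) zs → All ((x ∷ u) ≺_) (cartesianProductWith _∷_ zs ys)
  below u []           = []
  below u (x<z ∷ x<zs) = All.++⁺ (All.map⁺ (All.universal (λ _ → ≺-head x<z) ys)) (below u x<zs)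

-- This makes `box i` an alphabet to which `∑-sorted` applies, listed in the very order that
-- `IsPartition` asks of the columns.
box-≺ : ∀ {m} (i : MultiIndex m) → AllPairs _≺_ (box i)
box-≺ []       = [] ∷ []
box-≺ (n ∷ ns) = cartesianProductWith-∷-≺ (AllPairs.applyUpTo⁺₁ _ (suc n) (λ i<j _ → i<j)) (box-≺ ns)

-- The semiring of formal power series

module SeriesProperties {c ℓ₁ ℓ₂} (F : HeytingField c ℓ₁ ℓ₂) (char0 : CharacteristicZero F) where
  open Scalars F char0 using (commutativeRing; #⇒invertible; 1/_)
  open PowerSeries F char0

  scalarSemiring : CommutativeSemiring c ℓ₁
  scalarSemiring = CommutativeRing.commutativeSemiring commutativeRing

  open CommutativeRing commutativeRing hiding (zero)
  open import Algebra.Properties.Ring ring using (-0#≈0#)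
  open import Relation.Binary.Reasoning.Setoid setoid
  open Sums scalarSemiring
  open DividedPowers scalarSemiring using (⌜_⌝; module Divisible)

  1/-inverseˡ : ∀ n .{{_ : NonZero n}} → (1/ n) * ⌜ n ⌝ ≈ 1#
  1/-inverseˡ n = begin
    (1/ n) * ⌜ n ⌝          ≈⟨ *-congˡ (+-identityʳ _) ⟨
    (1/ n) * (⌜ n ⌝ + 0#)   ≈⟨ *-congˡ (+-congˡ -0#≈0#) ⟨
    (1/ n) * (⌜ n ⌝ - 0#)   ≈⟨ proj₁ (proj₂ (#⇒invertible (char0 n))) ⟩
    1#                      ∎

  open Divisible 1/_ 1/-inverseˡ public using (_!⁻¹; inv-*; inv-1)

  module _ {k : ℕ} where

    *ˢ-∑₂ : ∀ (f g : Series k) i → (f *ˢ g) i ≈ ∑₂ᵛ i (λ j l → f j * g l)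
    *ˢ-∑₂ f g i = ∑-box i (λ j l → f j * g l)

    -- The series x tᵘ. By definition `monoˢ 1# 𝟎` is `1ˢ`, so facts about monomials cover the unit
    -- as well.
    monoˢ : Carrier → MultiIndex k → Series k
    monoˢ x u i = when (i ≟ u) x

    monoˢ-* : ∀ x u y v → monoˢ x u *ˢ monoˢ y v ≈ˢ monoˢ (x * y) (u ⊞ v)
    monoˢ-* x u y v i = begin
      (monoˢ x u *ˢ monoˢ y v) i                          ≈⟨ *ˢ-∑₂ (monoˢ x u) (monoˢ y v) i ⟩
      ∑₂ᵛ i (λ j l → when (j ≟ u) x * when (l ≟ v) y)     ≈⟨ convolve (i ≟ u ⊞ v) ⟩
      when (i ≟ u ⊞ v) (x * y)                            ∎
      where
      off-u : ∀ j l → j ≢ u → when (j ≟ u) x * when (l ≟ v) y ≈ 0#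
      off-u j l j≢u = trans (*-congʳ (when-no (j ≟ u) j≢u)) (zeroˡ _)

      convolve : (d : Dec (i ≡ u ⊞ v)) →
                 ∑₂ᵛ i (λ j l → when (j ≟ u) x * when (l ≟ v) y) ≈ when d (x * y)
      convolve (yes i≡u⊞v) = trans
        (∑₂ᵛ-single i u v (≡.sym i≡u⊞v) (λ j l _ → off-u j l))
        (*-cong (when-yes (u ≟ u) ≡.refl) (when-yes (v ≟ v) ≡.refl))
      convolve (no i≢u⊞v) = ∑₂ᵛ-0 i vanish
        where
        vanish : ∀ j l → j ⊞ l ≡ i → when (j ≟ u) x * when (l ≟ v) y ≈ 0#
        vanish j l j⊞l≡i with j ≟ u
        ... | no _ = zeroˡ _
        ... | yes ≡.refl = trans
          (*-congˡ (when-no (l ≟ v) (λ { ≡.refl → i≢u⊞v (≡.sym j⊞l≡i) }))) (zeroʳ x)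

    monoˢ-𝟎-* : ∀ x (f : Series k) i → (monoˢ x 𝟎 *ˢ f) i ≈ x * f i
    monoˢ-𝟎-* x f i = begin
      (monoˢ x 𝟎 *ˢ f) i                       ≈⟨ *ˢ-∑₂ (monoˢ x 𝟎) f i ⟩
      ∑₂ᵛ i (λ j l → when (j ≟ 𝟎) x * f l)     ≈⟨ ∑₂ᵛ-single i 𝟎 i (⊞-identityˡ i) (λ j l _ j≢𝟎 →
                                                    trans (*-congʳ (when-no (j ≟ 𝟎) j≢𝟎)) (zeroˡ _)) ⟩
      when (𝟎 {k} ≟ 𝟎) x * f i                 ≈⟨ *-congʳ (when-yes (𝟎 {k} ≟ 𝟎) ≡.refl) ⟩
      x * f i                                  ∎

    *ˢ-cong : ∀ {f f′ g g′ : Series k} → f ≈ˢ f′ → g ≈ˢ g′ → f *ˢ g ≈ˢ f′ *ˢ g′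
    *ˢ-cong f≈f′ g≈g′ i = ∑-cong (box i) (λ j → *-cong (f≈f′ j) (g≈g′ _))

    *ˢ-assoc : ∀ (f g h : Series k) → (f *ˢ g) *ˢ h ≈ˢ f *ˢ (g *ˢ h)
    *ˢ-assoc f g h i = begin
      ((f *ˢ g) *ˢ h) i
        ≈⟨ *ˢ-∑₂ (f *ˢ g) h i ⟩
      ∑₂ᵛ i (λ a d → (f *ˢ g) a * h d)
        ≈⟨ ∑₂ᵛ-cong i (λ a d _ → trans (*-congʳ (*ˢ-∑₂ f g a)) (trans (*-comm _ _) (∑₂ᵛ-* a (h d) _))) ⟩
      ∑₂ᵛ i (λ a d → ∑₂ᵛ a (λ b e → h d * (f b * g e)))
        ≈⟨ ∑₂ᵛ-assoc i (λ b e d → h d * (f b * g e)) ⟩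
      ∑₂ᵛ i (λ b a → ∑₂ᵛ a (λ e d → h d * (f b * g e)))
        ≈⟨ ∑₂ᵛ-cong i (λ b a _ → ∑₂ᵛ-cong a (λ e d _ → trans (*-comm _ _) (*-assoc _ _ _))) ⟩
      ∑₂ᵛ i (λ b a → ∑₂ᵛ a (λ e d → f b * (g e * h d)))
        ≈⟨ ∑₂ᵛ-cong i (λ b a _ → trans (*-congˡ (*ˢ-∑₂ g h a)) (∑₂ᵛ-* a (f b) _)) ⟨
      ∑₂ᵛ i (λ b a → f b * (g *ˢ h) a)
        ≈⟨ *ˢ-∑₂ f (g *ˢ h) i ⟨
      (f *ˢ (g *ˢ h)) i ∎

    *ˢ-comm : ∀ (f g : Series k) → f *ˢ g ≈ˢ g *ˢ f
    *ˢ-comm f g i = begin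
      (f *ˢ g) i                       ≈⟨ *ˢ-∑₂ f g i ⟩
      ∑₂ᵛ i (λ j l → f j * g l)        ≈⟨ ∑₂ᵛ-comm i _ ⟩
      ∑₂ᵛ i (λ j l → f l * g j)        ≈⟨ ∑₂ᵛ-cong i (λ _ _ _ → *-comm _ _) ⟩
      ∑₂ᵛ i (λ j l → g j * f l)        ≈⟨ *ˢ-∑₂ g f i ⟨
      (g *ˢ f) i                       ∎

    *ˢ-identityˡ : ∀ (f : Series k) → 1ˢ *ˢ f ≈ˢ f
    *ˢ-identityˡ f i = trans (monoˢ-𝟎-* 1# f i) (*-identityˡ _)

    *ˢ-distribʳ : ∀ (h f g : Series k) → (λ i → f i + g i) *ˢ h ≈ˢ (λ i → (f *ˢ h) i + (g *ˢ h) i)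
    *ˢ-distribʳ h f g i = begin
      ((λ i → f i + g i) *ˢ h) i                                 ≈⟨ *ˢ-∑₂ (λ i → f i + g i) h i ⟩
      ∑₂ᵛ i (λ j l → (f j + g j) * h l)                          ≈⟨ ∑₂ᵛ-cong i (λ _ _ _ → distribʳ _ _ _) ⟩
      ∑₂ᵛ i (λ j l → f j * h l + g j * h l)                      ≈⟨ ∑₂ᵛ-+ i _ _ ⟩
      ∑₂ᵛ i (λ j l → f j * h l) + ∑₂ᵛ i (λ j l → g j * h l)      ≈⟨ +-cong (*ˢ-∑₂ f h i) (*ˢ-∑₂ g h i) ⟨
      (f *ˢ h) i + (g *ˢ h) i                                    ∎

  ≈ˢ-isEquivalence : ∀ {k} → IsEquivalence (_≈ˢ_ {k})
  ≈ˢ-isEquivalence = record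
    { refl  = λ _ → refl
    ; sym   = λ f≈g i → sym (f≈g i)
    ; trans = λ f≈g g≈h i → trans (f≈g i) (g≈h i)
    }

  seriesSemiring : ℕ → CommutativeSemiring c ℓ₁
  seriesSemiring k = record
    { Carrier = Series k
    ; _≈_     = _≈ˢ_
    ; _+_     = λ f g i → f i + g i
    ; _*_     = _*ˢ_
    ; 0#      = λ _ → 0#
    ; 1#      = 1ˢ
    ; isCommutativeSemiring = isCommutativeSemiringˡ record
      { +-isCommutativeMonoid = record
        { isMonoid = record
          { isSemigroup = record
            { isMagma = record
              { isEquivalence = ≈ˢ-isEquivalence
              ; ∙-cong        = λ p q i → +-cong (p i) (q i)
              }
            ; assoc = λ _ _ _ _ → +-assoc _ _ _
            }
          ; identity = (λ _ _ → +-identityˡ _) , (λ _ _ → +-identityʳ _)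
          }
        ; comm = λ _ _ _ → +-comm _ _
        }
      ; *-isCommutativeMonoid = record
        { isMonoid = record
          { isSemigroup = record
            { isMagma = record
              { isEquivalence = ≈ˢ-isEquivalence
              ; ∙-cong        = *ˢ-cong
              }
            ; assoc = *ˢ-assoc
            }
          ; identity = *ˢ-identityˡ , λ f i → trans (*ˢ-comm f 1ˢ i) (*ˢ-identityˡ f i)
          }
        ; comm = *ˢ-comm
        }
      ; distribʳ = *ˢ-distribʳ
      ; zeroˡ    = λ f i → trans (*ˢ-∑₂ (λ _ → 0#) f i) (∑₂ᵛ-0 i (λ _ _ _ → zeroˡ _))
      }
    }

  -- Powers of a series and their coefficients

  module _ {k : ℕ} where
    private
      module ˢ = CommutativeSemiring (seriesSemiring k)
      module Sumsˢ = Sums (seriesSemiring k)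
      module DPˢ = DividedPowers (seriesSemiring k)
    open import Algebra.Properties.Semiring.Exp ˢ.semiring using (^-homo-*)
      renaming (_^_ to _^′_)

    ^ˢ-≡ : ∀ (f : Series k) n → f ^ˢ n ≡ f ^′ n
    ^ˢ-≡ f zero    = ≡.refl
    ^ˢ-≡ f (suc n) = ≡.cong (f *ˢ_) (^ˢ-≡ f n)

    ^ˢ-+ : ∀ (f : Series k) m n → f ^ˢ (m ℕ.+ n) ≈ˢ f ^ˢ m *ˢ f ^ˢ n
    ^ˢ-+ f m n rewrite ^ˢ-≡ f (m ℕ.+ n) | ^ˢ-≡ f m | ^ˢ-≡ f n = ^-homo-* f m n

    monomialˢ-replicate : ∀ n (s : Series₀ k) (j : MultiIndex n) →
                          monomialˢ (replicate n s) j ≈ˢ proj₁ s ^ˢ ∣ j ∣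
    monomialˢ-replicate zero    s []       i = refl
    monomialˢ-replicate (suc n) s (j ∷ js) i = trans
      (*ˢ-cong (λ _ → refl) (monomialˢ-replicate n s js) i)
      (sym (^ˢ-+ (proj₁ s) j ∣ js ∣ i))

    -- In each product `f j * (f ^ˢ n) l` either j is `𝟎`, where f vanishes, or ∣ j ∣ ≥ 1 and l lies
    -- below the order n of the remaining power.
    ^ˢ-order : ∀ (f : Series k) → f 𝟎 ≈ 0# → ∀ n i → ∣ i ∣ ℕ.< n → (f ^ˢ n) i ≈ 0#
    ^ˢ-order f f₀≈0 (suc n) i ∣i∣≤n = trans (*ˢ-∑₂ f (f ^ˢ n) i) (∑₂ᵛ-0 i vanish)
      where
      vanish : ∀ j l → j ⊞ l ≡ i → f j * (f ^ˢ n) l ≈ 0#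
      vanish j l ≡.refl with ∣ j ∣ ℕ.≟ 0
      ... | yes ∣j∣≡0 rewrite ∣∣≡0⇒≡𝟎 j ∣j∣≡0 = trans (*-congʳ f₀≈0) (zeroˡ _)
      ... | no  ∣j∣≢0 = trans (*-congˡ (^ˢ-order f f₀≈0 n l ∣l∣<n)) (zeroʳ _)
        where
        ∣l∣<n : ∣ l ∣ ℕ.< n
        ∣l∣<n = ℕ.<-≤-trans (ℕ.m<n+m ∣ l ∣ (ℕ.n≢0⇒n>0 ∣j∣≢0))
          (≡.subst (ℕ._≤ n) (∣∣-⊞ j l) (ℕ.≤-pred ∣i∣≤n))

    -- The equation `j ⊞ l ≡ i` expresses j ≤ i, with l as witness: a coefficient of a power depends
    -- only on the coefficients below it. In the induction a ≤ l ≤ i, and the witness grows from b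
    -- to `b ⊞ j`. This is what permits replacing g by a finite sum.
    ^ˢ-local : ∀ (f g : Series k) n i → (∀ j l → j ⊞ l ≡ i → f j ≈ g j) → (f ^ˢ n) i ≈ (g ^ˢ n) i
    ^ˢ-local f g zero    i f≈g = refl
    ^ˢ-local f g (suc n) i f≈g = begin
      (f *ˢ f ^ˢ n) i
        ≈⟨ *ˢ-∑₂ f (f ^ˢ n) i ⟩
      ∑₂ᵛ i (λ j l → f j * (f ^ˢ n) l)
        ≈⟨ ∑₂ᵛ-cong i (λ j l j⊞l≡i → *-cong (f≈g j l j⊞l≡i)
             (^ˢ-local f g n l (λ a b a⊞b≡l → f≈g a (b ⊞ j) (shift a⊞b≡l j⊞l≡i)))) ⟩
      ∑₂ᵛ i (λ j l → g j * (g ^ˢ n) l)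
        ≈⟨ *ˢ-∑₂ g (g ^ˢ n) i ⟨
      (g *ˢ g ^ˢ n) i ∎
      where
      shift : ∀ {a b j l} → a ⊞ b ≡ l → j ⊞ l ≡ i → a ⊞ (b ⊞ j) ≡ i
      shift {a} {b} {j} ≡.refl j⊞l≡i =
        ≡.trans (≡.sym (⊞-assoc a b j)) (≡.trans (⊞-comm (a ⊞ b) j) j⊞l≡i)

    ∑ˢ-coeff : ∀ {b} {B : Set b} (xs : List B) (f : B → Series k) i → Sumsˢ.∑ xs f i ≡ ∑ xs (λ x → f x i)
    ∑ˢ-coeff []       f i = ≡.refl
    ∑ˢ-coeff (x ∷ xs) f i = ≡.cong (f x i +_) (∑ˢ-coeff xs f i)

    whenˢ-coeff : ∀ {p} {P : Set p} (P? : Dec P) (f : Series k) i → Sumsˢ.when P? f i ≡ when P? (f i)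
    whenˢ-coeff (yes _) f i = ≡.refl
    whenˢ-coeff (no _)  f i = ≡.refl

    -- Exponents add up under multiplication, and for a word read as a matrix of columns their sum
    -- is the vector of row sums. The row-sum condition on a partition thus becomes the extraction
    -- of one coefficient.
    ∏ˢ-monoˢ : ∀ (w : Matrix k) (g : Series k) →
               Sumsˢ.∏ w (λ v → monoˢ (g v) v) ≈ˢ monoˢ (∏ w g) (rowSums w)
    ∏ˢ-monoˢ []      g i = refl
    ∏ˢ-monoˢ (v ∷ w) g i = trans
      (*ˢ-cong (λ _ → refl) (∏ˢ-monoˢ w g) i)
      (monoˢ-* (g v) v (∏ w g) (rowSums w) i)

    ∑ˢ-monoˢ : ∀ (g : Series k) i j l → j ⊞ l ≡ i → Sumsˢ.∑ (box i) (λ v → monoˢ (g v) v) j ≈ g j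
    ∑ˢ-monoˢ g i j l j⊞l≡i = begin
      Sumsˢ.∑ (box i) (λ v → monoˢ (g v) v) j    ≡⟨ ∑ˢ-coeff (box i) _ j ⟩
      ∑ (box i) (λ v → when (j ≟ v) (g v))       ≈⟨ ∑-box i (λ v _ → when (j ≟ v) (g v)) ⟩
      ∑₂ᵛ i (λ v _ → when (j ≟ v) (g v))         ≈⟨ ∑₂ᵛ-single i j l j⊞l≡i
                                                      (λ v _ _ v≢j → when-no (j ≟ v) (v≢j ∘ ≡.sym)) ⟩
      when (j ≟ j) (g j)                         ≈⟨ when-yes (j ≟ j) ≡.refl ⟩
      g j                                        ∎

    invˢ : ∀ n → .{{NonZero n}} → Series k
    invˢ n = monoˢ (1/ n) 𝟎

    ⌜⌝ˢ-monoˢ : ∀ n → DPˢ.⌜ n ⌝ ≈ˢ monoˢ ⌜ n ⌝ 𝟎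
    ⌜⌝ˢ-monoˢ zero    i = sym (when-0 (i ≟ 𝟎) refl)
    ⌜⌝ˢ-monoˢ (suc n) i = trans (+-congˡ (⌜⌝ˢ-monoˢ n i)) (sym (when-+ (i ≟ 𝟎) 1# ⌜ n ⌝))

    invˢ-inverseˡ : ∀ n .{{_ : NonZero n}} → invˢ n *ˢ DPˢ.⌜ n ⌝ ≈ˢ 1ˢ
    invˢ-inverseˡ n i = begin
      (invˢ n *ˢ DPˢ.⌜ n ⌝) i     ≈⟨ monoˢ-𝟎-* (1/ n) DPˢ.⌜ n ⌝ i ⟩
      (1/ n) * DPˢ.⌜ n ⌝ i        ≈⟨ *-congˡ (⌜⌝ˢ-monoˢ n i) ⟩
      (1/ n) * when (i ≟ 𝟎) ⌜ n ⌝ ≈⟨ *-when (i ≟ 𝟎) _ _ ⟩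
      when (i ≟ 𝟎) ((1/ n) * ⌜ n ⌝) ≈⟨ when-congʳ (i ≟ 𝟎) (1/-inverseˡ n) ⟩
      1ˢ i                        ∎

    -- At the coefficient i, g may be replaced by the finite sum of its
    -- monomials g v tᵛ with v ∈ box i.
    ∑-sorted-coeff : ∀ (g : Series k) i l →
      ∑ (lists (box i) l) (λ w →
          when (sorted? w) ((1/ (𝔪 w !)) {{𝔪!≢0 w}} * when (i ≟ rowSums w) (∏ w g)))
        ≈ l !⁻¹ * (g ^ˢ l) i
    ∑-sorted-coeff g i l = begin
      ∑ (lists (box i) l) (λ w → when (sorted? w) (1/𝔪 w * when (i ≟ rowSums w) (∏ w g)))
        ≈⟨ ∑-cong (lists (box i) l) (λ w → when-congʳ (sorted? w) (trans
             (monoˢ-𝟎-* (1/𝔪 w) (Sumsˢ.∏ w mono) i) (*-congˡ (∏ˢ-monoˢ w g i)))) ⟨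
      ∑ (lists (box i) l) (λ w → when (sorted? w) ((monoˢ (1/𝔪 w) 𝟎 *ˢ Sumsˢ.∏ w mono) i))
        ≈⟨ ∑-cong (lists (box i) l) (λ w → reflexive (whenˢ-coeff (sorted? w) _ i)) ⟨
      ∑ (lists (box i) l) (λ w → Sumsˢ.when (sorted? w) (monoˢ (1/𝔪 w) 𝟎 *ˢ Sumsˢ.∏ w mono) i)
        ≡⟨ ∑ˢ-coeff (lists (box i) l) _ i ⟨
      Sumsˢ.∑ (lists (box i) l) (λ w → Sumsˢ.when (sorted? w) (monoˢ (1/𝔪 w) 𝟎 *ˢ Sumsˢ.∏ w mono)) i
        ≈⟨ SortedWords.∑-sorted (seriesSemiring k) k invˢ invˢ-inverseˡ (box-≺ i) l mono i ⟩
      (monoˢ (l !⁻¹) 𝟎 *ˢ (Sumsˢ.∑ (box i) mono ^′ l)) i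
        ≈⟨ monoˢ-𝟎-* (l !⁻¹) (Sumsˢ.∑ (box i) mono ^′ l) i ⟩
      l !⁻¹ * (Sumsˢ.∑ (box i) mono ^′ l) i
        ≡⟨ ≡.cong (λ f → l !⁻¹ * f i) (^ˢ-≡ (Sumsˢ.∑ (box i) mono) l) ⟨
      l !⁻¹ * (Sumsˢ.∑ (box i) mono ^ˢ l) i
        ≈⟨ *-congˡ (^ˢ-local (Sumsˢ.∑ (box i) mono) g l i (∑ˢ-monoˢ g i)) ⟩
      l !⁻¹ * (g ^ˢ l) i ∎
      where
      mono : MultiIndex k → Series k
      mono v = monoˢ (g v) v
      1/𝔪 : Matrix k → Carrier
      1/𝔪 w = (1/ (𝔪 w !)) {{𝔪!≢0 w}}

-- Moments and the comparison of coefficients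

module _ {c ℓ₁ ℓ₂ a} (F : HeytingField c ℓ₁ ℓ₂) (char0 : CharacteristicZero F) (A : Set a) where
  open Scalars F char0 using (commutativeRing; 1/_)
  open Umbral F char0 A
  open SeriesProperties F char0
  open CommutativeRing commutativeRing hiding (zero)
  open import Algebra.Properties.Ring ring using (-0#≈0#)
  open CommutativeSemigroupProperties *-commutativeSemigroup using (interchange; x∙yz≈y∙xz)
  open import Relation.Binary.Reasoning.Setoid setoid
  open Sums scalarSemiring

  private
    module R = CommutativeRing polynomialRing
    module Sumsᴿ = Sums R.commutativeSemiring
    module DPᴿ = DividedPowers R.commutativeSemiring

  1/!ᵛ : ∀ {k} → MultiIndex k → Carrier
  1/!ᵛ i = (1/ (i !ᵛ)) {{ !ᵛ≢0 i}}

  1/!ᴹ : ∀ {m} → Matrix m → Carrier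
  1/!ᴹ Λ = (1/ (Λ !ᴹ)) {{product-map≢0 _ !ᵛ≢0 Λ}}

  1/𝔪 : ∀ {m} → Matrix m → Carrier
  1/𝔪 Λ = (1/ (𝔪 Λ !)) {{𝔪!≢0 Λ}}

  1/!ᵛ-∷ : ∀ {k} n (i : MultiIndex k) → 1/!ᵛ (n ∷ i) ≈ n !⁻¹ * 1/!ᵛ i
  1/!ᵛ-∷ n i = inv-* (n !) (i !ᵛ) {{ℕ._!≢0 n}} {{ !ᵛ≢0 i}} {{ !ᵛ≢0 (n ∷ i)}}

  1/!ᵛ-𝟎 : ∀ k → 1/!ᵛ (𝟎 {k}) ≈ 1#
  1/!ᵛ-𝟎 zero    = inv-1
  1/!ᵛ-𝟎 (suc k) = trans (1/!ᵛ-∷ 0 (𝟎 {k})) (trans (*-cong inv-1 (1/!ᵛ-𝟎 k)) (*-identityˡ 1#))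

  1/!ᴹ-∏ : ∀ {m} (Λ : Matrix m) → 1/!ᴹ Λ ≈ ∏ Λ 1/!ᵛ
  1/!ᴹ-∏ []      = inv-1
  1/!ᴹ-∏ (v ∷ Λ) = trans
    (inv-* (v !ᵛ) (Λ !ᴹ) {{ !ᵛ≢0 v}} {{product-map≢0 _ !ᵛ≢0 Λ}} {{product-map≢0 _ !ᵛ≢0 (v ∷ Λ)}})
    (*-congˡ (1/!ᴹ-∏ Λ))

  con-× : ∀ n → DPᴿ.⌜ n ⌝ ≋ con (DividedPowers.⌜_⌝ scalarSemiring n)
  con-× zero    = ≋-refl
  con-× (suc n) = ≋-trans (⊕-cong ≋-refl (con-× n)) (≋-sym (con-+ _ _))

  con-inverseˡ : ∀ n .{{_ : NonZero n}} → con (1/ n) ⊗ DPᴿ.⌜ n ⌝ ≋ con 1#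
  con-inverseˡ n = ≋-trans (⊗-cong ≋-refl (con-× n))
    (≋-trans (≋-sym (con-* _ _)) (con-cong (1/-inverseˡ n)))

  module DDᴿ = DPᴿ.Divisible (λ n → con (1/ n)) con-inverseˡ

  -- Collecting the factors 1/jₖ! into one scalar gives the terms of `multinomial` the shape from
  -- which linearity of E extracts a moment.
  divided-^ᵗ : ∀ {n} (μ : Vec Monomial n) (j : MultiIndex n) →
               Vec.map ⟦_⟧ μ DDᴿ.^[ j ]ᵛ ≋ con (1/!ᵛ j) ⊗ μ ^ᵗ j
  divided-^ᵗ []      []       = ≋-sym (≋-trans (R.*-identityʳ _) (con-cong inv-1))
  divided-^ᵗ (M ∷ μ) (j ∷ js) = ≋-trans
    (⊗-cong ≋-refl (divided-^ᵗ μ js))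
    (≋-trans (R-interchange _ _ _ _)
      (⊗-cong (≋-trans (≋-sym (con-* _ _)) (con-cong (sym (1/!ᵛ-∷ j js)))) ≋-refl))
    where
    open CommutativeSemigroupProperties R.*-commutativeSemigroup
      using () renaming (interchange to R-interchange)

  module _ (ev : Evaluation) where
    open Evaluation ev
    open LeftModuleMorphisms.IsLeftModuleHomomorphism linear
      using () renaming (+ᴹ-homo to E-⊕; 0ᴹ-homo to E-0; ⟦⟧-cong to E-cong; *ₗ-homo to E-con-⊗)

    E-∑₂ : ∀ n f → E (Sumsᴿ.∑₂ n f) ≈ ∑₂ n (λ a b → E (f a b))
    E-∑₂ zero    f = refl
    E-∑₂ (suc n) f = trans (E-⊕ _ _) (+-congˡ (E-∑₂ n (λ a b → f (suc a) b)))

    E-∑ᵈ : ∀ n l f → E (Sumsᴿ.∑ᵈ n l f) ≈ ∑ᵈ n l (E ∘ f)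
    E-∑ᵈ zero    zero    f = refl
    E-∑ᵈ zero    (suc l) f = E-0
    E-∑ᵈ (suc n) l       f = trans (E-∑₂ l _) (∑₂-cong l (λ a b _ → E-∑ᵈ n b (λ j → f (a ∷ j))))

    moment-𝟎 : ∀ {k} (μ : Vec Monomial k) → moment ev μ 𝟎 ≈ 1#
    moment-𝟎 μ = trans (E-cong (^ᵗ-𝟎 μ)) normalised
      where
      ^ᵗ-𝟎 : ∀ {k} (μ : Vec Monomial k) → μ ^ᵗ 𝟎 ≋ con 1#
      ^ᵗ-𝟎 []      = ≋-refl
      ^ᵗ-𝟎 (M ∷ μ) = ≋-trans (⊗-identityˡ _) (^ᵗ-𝟎 μ)

    -- The coefficient 1 that `egf` prescribes at `𝟎` agrees with the general formula because E[1] =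
    -- 1.
    egf-moment : ∀ {k} (μ : Vec Monomial k) i → egf (moment ev μ) i ≈ 1/!ᵛ i * moment ev μ i
    egf-moment {k} μ i with i ≟ 𝟎
    ... | yes ≡.refl = sym (trans (*-cong (1/!ᵛ-𝟎 k) (moment-𝟎 μ)) (*-identityˡ 1#))
    ... | no _       = *-comm _ _

    -- The expansion takes place inside R[A], before E is applied: the monomials of μ may share
    -- umbrae, so E need not be multiplicative on their products, but it is linear.
    total-multinomial : ∀ {n} (μ : Vec Monomial n) l →
                        ∑ᵈ n l (egf (moment ev μ)) ≈ l !⁻¹ * E (total μ ^ᵖ l)
    total-multinomial {n} μ l = begin
      ∑ᵈ n l (egf (moment ev μ))
        ≈⟨ ∑ᵈ-cong n l (egf-moment μ) ⟩
      ∑ᵈ n l (λ j → 1/!ᵛ j * E (μ ^ᵗ j))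
        ≈⟨ ∑ᵈ-cong n l (λ j → E-con-⊗ _ _) ⟨
      ∑ᵈ n l (λ j → E (con (1/!ᵛ j) ⊗ μ ^ᵗ j))
        ≈⟨ ∑ᵈ-cong n l (λ j → E-cong (divided-^ᵗ μ j)) ⟨
      ∑ᵈ n l (λ j → E (Vec.map ⟦_⟧ μ DDᴿ.^[ j ]ᵛ))
        ≈⟨ E-∑ᵈ n l _ ⟨
      E (Sumsᴿ.∑ᵈ n l (Vec.map ⟦_⟧ μ DDᴿ.^[_]ᵛ))
        ≈⟨ E-cong (DDᴿ.multinomial (Vec.map ⟦_⟧ μ) l) ⟨
      E (con (l !⁻¹) ⊗ total μ ^ᵖ l)
        ≈⟨ E-con-⊗ _ _ ⟩
      l !⁻¹ * E (total μ ^ᵖ l) ∎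

    module _ {m : ℕ} (ν : Vec Monomial m) where

      G : Series m
      G = proj₁ (egf-1 (moment ev ν))

      G-𝟎 : G 𝟎 ≈ 0#
      G-𝟎 = proj₂ (egf-1 (moment ev ν))

      G-≢𝟎 : ∀ {v} → v ≢ 𝟎 → moment ev ν v * 1/!ᵛ v ≈ G v
      G-≢𝟎 {v} v≢𝟎 with v ≟ 𝟎
      ... | yes v≡𝟎 = contradiction v≡𝟎 v≢𝟎
      ... | no  _   = sym (trans (+-congˡ -0#≈0#) (+-identityʳ _))

      ∏-G-0 : ∀ Λ → ¬ All (_≢ 𝟎) Λ → ∏ Λ G ≈ 0#
      ∏-G-0 []      ¬all = contradiction [] ¬all
      ∏-G-0 (v ∷ Λ) ¬all = by (v ≟ 𝟎)
        where
        by : Dec (v ≡ 𝟎) → G v * ∏ Λ G ≈ 0#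
        by (yes ≡.refl) = trans (*-congʳ G-𝟎) (zeroˡ _)
        by (no v≢𝟎)     = trans (*-congˡ (∏-G-0 Λ (λ all → ¬all (v≢𝟎 ∷ all)))) (zeroʳ _)

      -- Of the three conditions in `IsPartition`, sortedness stays and the row sums turn into a
      -- test on the exponent. The ban on zero columns is enforced by the weight instead: the factor
      -- of a zero column is `G 𝟎` ≈ 0 on the right, whereas its moment is 1.
      partition-term : ∀ i Λ →
        when (isPartition? i Λ) (1/𝔪 Λ * ∏ Λ (λ v → moment ev ν v * 1/!ᵛ v))
          ≈ when (sorted? Λ) (1/𝔪 Λ * when (i ≟ rowSums Λ) (∏ Λ G))
      partition-term i Λ = by (isPartition? i Λ) (sorted? Λ) (i ≟ rowSums Λ)
        where
        by : (p? : Dec (IsPartition i Λ)) (s? : Dec (Linked (TotalOrder._≤_ (lex m)) Λ))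
             (r? : Dec (i ≡ rowSums Λ)) →
             when p? (1/𝔪 Λ * ∏ Λ (λ v → moment ev ν v * 1/!ᵛ v)) ≈ when s? (1/𝔪 Λ * when r? (∏ Λ G))
        by (yes (≢𝟎 , _ , _)) (yes _) (yes _) = *-congˡ (∏-congᴬ (All.map G-≢𝟎 ≢𝟎))
        by (yes (_ , s , _))  (no ¬s) _       = contradiction s ¬s
        by (yes (_ , _ , r))  (yes _) (no ¬r) = contradiction (≡.sym r) ¬r
        by (no _)             (no _)  _       = refl
        by (no _)             (yes _) (no _)  = sym (zeroʳ _)
        by (no ¬p)            (yes s) (yes r) =
          sym (trans (*-congˡ (∏-G-0 Λ (λ ≢𝟎 → ¬p (≢𝟎 , s , ≡.sym r)))) (zeroʳ _))

      -- The candidates for partitions are grouped by length l, on which alone the factor E[pˡ]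
      -- depends, and i! cancels against the 1/i! of `egf`. The bound ∣ i ∣ on the length is also
      -- the degree beyond which the terms of the substitution vanish, so both sides of the theorem
      -- meet in this sum.
      momentβ-coeff : ∀ p i → momentβ ev p ν i * 1/!ᵛ i
                            ≈ ∑₂ (∣ i ∣) (λ l _ → (G ^ˢ l) i * (l !⁻¹ * E (p ^ᵖ l)))
      momentβ-coeff p i = begin
        momentβ ev p ν i * 1/!ᵛ i
          ≈⟨ trans (*-comm _ _) (∑-* (partitions i) (1/!ᵛ i) _) ⟩
        ∑ (partitions i) (λ Λ → 1/!ᵛ i * (i! * 1/𝔪! Λ * E (p ^ᵖ List.length Λ) * ∏ Λ (moment ev ν)))
          ≈⟨ ∑-cong (partitions i) simplify ⟩
        ∑ (partitions i) W
          ≈⟨ ∑-filter (isPartition? i) (List.concatMap (lists (box i)) (upTo (suc (∣ i ∣)))) W ⟩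
        ∑ (List.concatMap (lists (box i)) (upTo (suc (∣ i ∣)))) (λ Λ → when (isPartition? i Λ) (W Λ))
          ≈⟨ ∑-concatMap (lists (box i)) (upTo (suc (∣ i ∣))) _ ⟩
        ∑ (upTo (suc (∣ i ∣))) (λ l → ∑ (lists (box i) l) (λ Λ → when (isPartition? i Λ) (W Λ)))
          ≈⟨ ∑-cong (upTo (suc (∣ i ∣))) of-length ⟩
        ∑ (upTo (suc (∣ i ∣))) (λ l → (G ^ˢ l) i * (l !⁻¹ * E (p ^ᵖ l)))
          ≈⟨ ∑-upTo (∣ i ∣) (λ l _ → (G ^ˢ l) i * (l !⁻¹ * E (p ^ᵖ l))) ⟩
        ∑₂ (∣ i ∣) (λ l _ → (G ^ˢ l) i * (l !⁻¹ * E (p ^ᵖ l))) ∎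
        where
        open DividedPowers scalarSemiring using (⌜_⌝)

        i! : Carrier
        i! = ⌜ i !ᵛ ⌝

        1/𝔪! : Matrix m → Carrier
        1/𝔪! Λ = (1/ (𝔪 Λ ! ℕ.* Λ !ᴹ)) {{𝔪Λ!*Λ!≢0 Λ}}

        W : Matrix m → Carrier
        W Λ = E (p ^ᵖ List.length Λ) * (1/𝔪 Λ * ∏ Λ (λ v → moment ev ν v * 1/!ᵛ v))

        simplify : ∀ Λ → 1/!ᵛ i * (i! * 1/𝔪! Λ * E (p ^ᵖ List.length Λ) * ∏ Λ (moment ev ν)) ≈ W Λ
        simplify Λ = begin
          1/!ᵛ i * (i! * 1/𝔪! Λ * e * h)
            ≈⟨ *-congˡ (trans (*-assoc _ _ _) (*-assoc _ _ _)) ⟩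
          1/!ᵛ i * (i! * (1/𝔪! Λ * (e * h)))
            ≈⟨ *-assoc _ _ _ ⟨
          1/!ᵛ i * i! * (1/𝔪! Λ * (e * h))
            ≈⟨ trans (*-congʳ (1/-inverseˡ (i !ᵛ) {{ !ᵛ≢0 i}})) (*-identityˡ _) ⟩
          1/𝔪! Λ * (e * h)
            ≈⟨ x∙yz≈y∙xz _ _ _ ⟩
          e * (1/𝔪! Λ * h)
            ≈⟨ *-congˡ (*-congʳ (inv-* (𝔪 Λ !) (Λ !ᴹ)
                 {{𝔪!≢0 Λ}} {{product-map≢0 _ !ᵛ≢0 Λ}} {{𝔪Λ!*Λ!≢0 Λ}})) ⟩
          e * (1/𝔪 Λ * 1/!ᴹ Λ * h)
            ≈⟨ *-congˡ (trans (*-assoc _ _ _) (*-congˡ (*-comm _ _))) ⟩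
          e * (1/𝔪 Λ * (h * 1/!ᴹ Λ))
            ≈⟨ *-congˡ (*-congˡ (*-congˡ (1/!ᴹ-∏ Λ))) ⟩
          e * (1/𝔪 Λ * (h * ∏ Λ 1/!ᵛ))
            ≈⟨ *-congˡ (*-congˡ (∏-* Λ (moment ev ν) 1/!ᵛ)) ⟨
          W Λ ∎
          where
          e = E (p ^ᵖ List.length Λ)
          h = ∏ Λ (moment ev ν)

        of-length : ∀ l → ∑ (lists (box i) l) (λ Λ → when (isPartition? i Λ) (W Λ))
                        ≈ (G ^ˢ l) i * (l !⁻¹ * E (p ^ᵖ l))
        of-length l = begin
          ∑ (lists (box i) l) (λ Λ → when (isPartition? i Λ) (W Λ))
            -- Matching on the length turns `E (p ^ᵖ List.length Λ)` into `E (p ^ᵖ l)`, which can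
            -- then leave the sum.
            ≈⟨ ∑-congᴬ (All.map (λ { {Λ} (≡.refl , _) →
                 trans (sym (*-when (isPartition? i Λ) _ _)) (*-congˡ (partition-term i Λ)) })
                 (lists-All (All.universal-U (box i)) l)) ⟩
          ∑ (lists (box i) l) (λ Λ → E (p ^ᵖ l) * when (sorted? Λ) (1/𝔪 Λ * when (i ≟ rowSums Λ) (∏ Λ G)))
            ≈⟨ ∑-* (lists (box i) l) (E (p ^ᵖ l)) _ ⟨
          E (p ^ᵖ l) * ∑ (lists (box i) l) (λ Λ → when (sorted? Λ) (1/𝔪 Λ * when (i ≟ rowSums Λ) (∏ Λ G)))
            ≈⟨ *-congˡ (∑-sorted-coeff G i l) ⟩
          E (p ^ᵖ l) * (l !⁻¹ * (G ^ˢ l) i)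
            ≈⟨ trans (*-comm _ _) (trans (*-congʳ (*-comm _ _)) (*-assoc _ _ _)) ⟩
          (G ^ˢ l) i * (l !⁻¹ * E (p ^ᵖ l)) ∎

      composition-coeff : ∀ {n} (μ : Vec Monomial n) i →
        (egf (moment ev μ) ⟦ replicate n (egf-1 (moment ev ν)) ⟧ˢ) i
          ≈ ∑₂ (∣ i ∣) (λ l _ → (G ^ˢ l) i * (l !⁻¹ * E (total μ ^ᵖ l)))
      composition-coeff {n} μ i = begin
        ∑ (box (replicate n (∣ i ∣))) (λ j → f j * monomialˢ (replicate n (egf-1 (moment ev ν))) j i)
          ≈⟨ ∑-cong (box (replicate n (∣ i ∣))) (λ j → trans
               (*-congˡ (monomialˢ-replicate n (egf-1 (moment ev ν)) j i)) (*-comm _ _)) ⟩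
        ∑ (box (replicate n (∣ i ∣))) (λ j → (G ^ˢ ∣ j ∣) i * f j)
          -- The power of `G` now depends on j only through ∣ j ∣, and it has no coefficient at i
          -- once ∣ j ∣ > ∣ i ∣, as `G` has no constant term. The cube thus reduces to its layers of
          -- degree l ≤ ∣ i ∣.
          ≈⟨ ∑-cube n (∣ i ∣) (λ l j → (G ^ˢ l) i * f j)
               (λ l j ∣i∣<l → trans (*-congʳ (^ˢ-order G G-𝟎 l i ∣i∣<l)) (zeroˡ _)) ⟩
        ∑₂ (∣ i ∣) (λ l _ → ∑ᵈ n l (λ j → (G ^ˢ l) i * f j))
          ≈⟨ ∑₂-cong (∣ i ∣) (λ l _ _ → trans (*-congˡ (sym (total-multinomial μ l))) (∑ᵈ-* n l _ _)) ⟨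
        ∑₂ (∣ i ∣) (λ l _ → (G ^ˢ l) i * (l !⁻¹ * E (total μ ^ᵖ l))) ∎
        where
        f = egf (moment ev μ)

      -- At `𝟎` the left side of the theorem is 1 by definition of `egf` and does not mention
      -- `momentβ`. On the right only l = 0 remains, with value E[p⁰]/0! = 1.
      composition-𝟎 : ∀ {n} (μ : Vec Monomial n) →
        (egf (moment ev μ) ⟦ replicate n (egf-1 (moment ev ν)) ⟧ˢ) 𝟎 ≈ 1#
      composition-𝟎 μ = begin
        _
          ≈⟨ composition-coeff μ 𝟎 ⟩
        ∑₂ (∣ 𝟎 {m} ∣) term
          ≡⟨ ≡.cong (λ N → ∑₂ N term) (∣𝟎∣≡0 m) ⟩
        1ˢ (𝟎 {m}) * (0 !⁻¹ * E (con 1#))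
          ≈⟨ *-cong (when-yes (𝟎 {m} ≟ 𝟎) ≡.refl) (*-cong inv-1 normalised) ⟩
        1# * (1# * 1#)
          ≈⟨ trans (*-identityˡ _) (*-identityˡ _) ⟩
        1# ∎
        where
        term = λ l (_ : ℕ) → (G ^ˢ l) 𝟎 * (l !⁻¹ * E (total μ ^ᵖ l))

theorem3p4 : ∀ {c ℓ₁ ℓ₂ a} (F : HeytingField c ℓ₁ ℓ₂) (char0 : CharacteristicZero F) (A : Set a) →
    let open Umbral F char0 A in
    (ev : Evaluation) (n m : ℕ) (μ : Vec Monomial n) (ν : Vec Monomial m) →
    egf (momentβ ev (total μ) ν)
    ≈ˢ egf (moment ev μ) ⟦ replicate n (egf-1 (moment ev ν)) ⟧ˢ
theorem3p4 F char0 A ev n m μ ν i with i ≟ 𝟎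
... | yes ≡.refl = sym (composition-𝟎 F char0 A ev ν μ)
  where open HeytingField F
... | no _ = trans
  (momentβ-coeff F char0 A ev ν (Umbral.total F char0 A μ) i)
  (sym (composition-coeff F char0 A ev ν μ i))
  where open HeytingField F
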